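{- Let $G=(V,E)$ be a finite undirected graph and let $f:2^V\to\mathbb{Z}$ be weakly supermodular, symmetric and normalized. There is a partition $V_1,V_2,\ldots,V_k$ of $V$ and weakly supermodular, symmetric, and normalized functions $f_i:2^{V_i}\to\mathbb{Z}$ ($i\in[k]$) such that the following hold. (a) $F\subseteq E$ is a feasible solution to $\mathrm{CR}\text{ - }(f,G)\text{ - }\mathrm{NDP}$ if and only if, for all $i\in[k]$, $F\supseteq\delta_G(V_i)$ and $F(V_i)$ is a feasible solution to $(f_i,G[V_i])\text{ - }\mathrm{NDP}$. (b) $x\in\mathbb{R}^E$ is feasible to $(\mathrm{CRLP}_{f,G})$ if and only if, for all $i\in[k]$, we have $x_e=1$ for all $e\in\delta_G(V_i)$, and $x^{V_i}$ is feasible to $(\mathrm{NDP}_{f_i,G[V_i]})$. (c) $x$ is an extreme-point solution to $(\mathrm{CRLP}_{f,G})$ if and only if, for all $i\in[k]$, we have $x_e=1$ for all $e\in\delta_G(V_i)$, and $x^{V_i}$ is an extreme-point solution to $(\mathrm{NDP}_{f_i,G[V_i]})$.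
   Context: For a graph $D=(V_D,E_D)$, $S\subseteq V_D$ and $Z\subseteq E_D$: $\delta_D(S)$ is the set of edges of $D$ with exactly one end in $S$; $\delta_Z(S)=\delta_D(S)\cap Z$; $D[S]$ is the subgraph induced by $S$; $Z(S)$ is the set of edges of $Z$ with both ends in $S$. For $x\in\mathbb{R}^{E_D}$ and $Z\subseteq E_D$, $x(Z)=\sum_{e\in Z}x_e$, and $x^S=(x_e)_{e\in E_D(S)}$ is the restriction of $x$ to edges with both ends in $S$. A function $h:2^{U}\to\mathbb{R}$ is weakly supermodular if for all $A,B\subseteq U$, $h(A)+h(B)\le\max\{h(A\cap B)+h(A\cup B),\ h(A-B)+h(B-A)\}$; symmetric if $h(S)=h(U-S)$ for all $S\subseteq U$; normalized if $h(\emptyset)=h(U)=0$. For a graph $D=(V_D,E_D)$ and $h:2^{V_D}\to\mathbb{Z}$: $H\subseteq E_D$ is feasible for $(h,D)\text{ - }\mathrm{NDP}$ if $|\delta_H(S)|\ge h(S)$ for all $S\subseteq V_D$; $H\subseteq E_D$ is feasible for $\mathrm{CR}\text{ - }(h,D)\text{ - }\mathrm{NDP}$ if $|\delta_H(S)|\ge\min\{h(S),|\delta_D(S)|\}$ for all $S\subseteq V_D$. The feasible region of the LP $(\mathrm{CRLP}_{h,D})$ consists of all $x\in\mathbb{R}^{E_D}$ with $x(\delta_D(S))\ge\min\{h(S),|\delta_D(S)|\}$ for all $S\subseteq V_D$ and $0\le x_e\le1$ for all $e\in E_D$. The feasible region of the LP $(\mathrm{NDP}_{h,D})$ consists of all $x\in\mathbb{R}^{E_D}$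 with $x(\delta_D(S))\ge h(S)$ for all $S\subseteq V_D$ and $0\le x_e\le1$ for all $e\in E_D$. An extreme-point solution of an LP is an extreme point of its feasible region. -}

module Defs where

open import Level using (0ℓ)
open import Algebra.Bundles.Raw using (RawMonoid)
import Algebra.Definitions.RawMonoid as RawMonoidDefs
open import Data.Bool.Base using (true; false; _∧_; _xor_)
open import Data.Fin.Base using (Fin)
open import Data.Fin.Subset as Subset using (Subset; _∈_; _⊆_; _∩_; _∪_; _─_; ∣_∣; Nonempty; Empty)
open import Data.Fin.Subset.Properties
  using (_∈?_; p∩q⊆p; x∈p∩q⁻; x∈p∩q⁺; x∈p∪q⁻; p─q⊆p; ⊆-refl; ⊆-min)
import Data.Integer as ℤ
open ℤ using (ℤ; +_)
open import Data.Irrelevant using ([_])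
open import Data.Nat.Base as ℕ using (ℕ)
import Data.Nat.Properties as ℕₚ
open import Data.Product.Base using (∃-syntax; _×_; _,_; proj₁; proj₂)
open import Data.Rational as ℚ using (ℚ; 0ℚ; 1ℚ; ½)
import Data.Rational.Properties as ℚₚ
open import Data.Rational.Solver using (module +-*-Solver)
open import Data.Refinement as Refinement using (Refinement-syntax; value; _,_)
open import Data.Sum.Base using ([_,_]′)
open import Data.Vec.Base using (lookup; tabulate)
open import Data.Vec.Properties using ([]=⇒lookup; lookup∘tabulate; lookup⇒[]=)
open import Function.Base using (_∘_)
open import Relation.Binary.PropositionalEquality
open import Relation.Nullary using (yes; no)

------------------------------------------------------------------------
-- Real numbers: Cauchy sequences of rationals, compared through their
-- limits.  Equality of reals is _≈ᵣ_, not _≡_.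

IsCauchy : (ℕ → ℚ) → Set
IsCauchy s = ∀ ε → 0ℚ ℚ.< ε →
  ∃[ N ] ∀ m n → N ℕ.≤ m → N ℕ.≤ n → ℚ.∣ s m ℚ.- s n ∣ ℚ.≤ ε

record ℝ : Set where
  constructor mkℝ
  field
    seq    : ℕ → ℚ
    cauchy : IsCauchy seq
open ℝ public

infix 4 _≈ᵣ_ _≤ᵣ_ _<ᵣ_

_≈ᵣ_ : ℝ → ℝ → Set
x ≈ᵣ y = ∀ ε → 0ℚ ℚ.< ε → ∃[ N ] ∀ n → N ℕ.≤ n → ℚ.∣ seq x n ℚ.- seq y n ∣ ℚ.≤ ε

_≤ᵣ_ : ℝ → ℝ → Set
x ≤ᵣ y = ∀ ε → 0ℚ ℚ.< ε → ∃[ N ] ∀ n → N ℕ.≤ n → seq x n ℚ.≤ seq y n ℚ.+ ε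

_<ᵣ_ : ℝ → ℝ → Set
x <ᵣ y = ∃[ ε ] 0ℚ ℚ.< ε × ∃[ N ] ∀ n → N ℕ.≤ n → seq x n ℚ.+ ε ℚ.≤ seq y n

module CauchyLemmas where

  half+half : ∀ ε → ½ ℚ.* ε ℚ.+ ½ ℚ.* ε ≡ ε
  half+half ε = trans (sym (ℚₚ.*-distribʳ-+ ε ½ ½)) (ℚₚ.*-identityˡ ε)

  half-pos : ∀ {ε} → 0ℚ ℚ.< ε → 0ℚ ℚ.< ½ ℚ.* ε
  half-pos {ε} 0<ε = subst (ℚ._< ½ ℚ.* ε) (ℚₚ.*-zeroʳ ½) (ℚₚ.*-monoʳ-<-pos ½ 0<ε)

  const-cauchy : ∀ q → IsCauchy (λ _ → q)
  const-cauchy q ε 0<ε = 0 , λ _ _ _ _ →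
    subst (λ d → ℚ.∣ d ∣ ℚ.≤ ε) (sym (ℚₚ.+-inverseʳ q)) (ℚₚ.<⇒≤ 0<ε)

  neg-cauchy : ∀ {s} → IsCauchy s → IsCauchy (ℚ.-_ ∘ s)
  neg-cauchy {s} cs ε 0<ε with cs ε 0<ε
  ... | N , close = N , λ m n N≤m N≤n →
    subst (ℚ._≤ ε)
      (trans (sym (ℚₚ.∣-p∣≡∣p∣ (s m ℚ.- s n)))
             (cong ℚ.∣_∣ (ℚₚ.neg-distrib-+ (s m) (ℚ.- s n))))
      (close m n N≤m N≤n)

  +-cauchy : ∀ {s t} → IsCauchy s → IsCauchy t → IsCauchy (λ n → s n ℚ.+ t n)
  +-cauchy {s} {t} cs ct ε 0<ε
    with cs (½ ℚ.* ε) (half-pos 0<ε) | ct (½ ℚ.* ε) (half-pos 0<ε)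
  ... | M , closeₛ | N , closeₜ = M ℕ.⊔ N , λ m n ≤m ≤n → begin
    ℚ.∣ (s m ℚ.+ t m) ℚ.- (s n ℚ.+ t n) ∣
      ≡⟨ cong ℚ.∣_∣ (rearrange (s m) (t m) (s n) (t n)) ⟩
    ℚ.∣ (s m ℚ.- s n) ℚ.+ (t m ℚ.- t n) ∣
      ≤⟨ ℚₚ.∣p+q∣≤∣p∣+∣q∣ (s m ℚ.- s n) (t m ℚ.- t n) ⟩
    ℚ.∣ s m ℚ.- s n ∣ ℚ.+ ℚ.∣ t m ℚ.- t n ∣
      ≤⟨ ℚₚ.+-mono-≤
           (closeₛ m n (ℕₚ.m⊔n≤o⇒m≤o M N ≤m) (ℕₚ.m⊔n≤o⇒m≤o M N ≤n))
           (closeₜ m n (ℕₚ.m⊔n≤o⇒n≤o M N ≤m) (ℕₚ.m⊔n≤o⇒n≤o M N ≤n)) ⟩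
    ½ ℚ.* ε ℚ.+ ½ ℚ.* ε
      ≡⟨ half+half ε ⟩
    ε ∎
    where
    open ℚₚ.≤-Reasoning
    open +-*-Solver
    rearrange : ∀ a b c d → (a ℚ.+ b) ℚ.- (c ℚ.+ d) ≡ (a ℚ.- c) ℚ.+ (b ℚ.- d)
    rearrange = solve 4 (λ a b c d → (a :+ b) :- (c :+ d) := (a :- c) :+ (b :- d)) refl

  eventually-bounded : ∀ {s} → IsCauchy s →
    ∃[ B ] 0ℚ ℚ.< B × ∃[ N ] ∀ n → N ℕ.≤ n → ℚ.∣ s n ∣ ℚ.≤ B
  eventually-bounded {s} cs with cs 1ℚ (ℚₚ.positive⁻¹ 1ℚ)
  ... | N , close = 1ℚ ℚ.+ ℚ.∣ s N ∣
                  , ℚₚ.+-mono-<-≤ (ℚₚ.positive⁻¹ 1ℚ) (ℚₚ.0≤∣p∣ (s N))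
                  , N , λ n N≤n → begin
    ℚ.∣ s n ∣
      ≡⟨ cong ℚ.∣_∣ (solve 2 (λ a b → a := (a :- b) :+ b) refl (s n) (s N)) ⟩
    ℚ.∣ (s n ℚ.- s N) ℚ.+ s N ∣
      ≤⟨ ℚₚ.∣p+q∣≤∣p∣+∣q∣ (s n ℚ.- s N) (s N) ⟩
    ℚ.∣ s n ℚ.- s N ∣ ℚ.+ ℚ.∣ s N ∣
      ≤⟨ ℚₚ.+-monoˡ-≤ ℚ.∣ s N ∣ (close n N N≤n ℕₚ.≤-refl) ⟩
    1ℚ ℚ.+ ℚ.∣ s N ∣ ∎
    where
    open ℚₚ.≤-Reasoning
    open +-*-Solver

  -- A positive δ with B * δ = ε.
  divide : ∀ B ε → 0ℚ ℚ.< B → 0ℚ ℚ.< ε → ∃[ δ ] 0ℚ ℚ.< δ × B ℚ.* δ ≡ ε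
  divide B ε 0<B 0<ε = δ , 0<δ , B*δ≡ε
    where
    instance
      posB : ℚ.Positive B
      posB = ℚ.positive 0<B
      posε : ℚ.Positive ε
      posε = ℚ.positive 0<ε
      nzB : ℚ.NonZero B
      nzB = ℚₚ.pos⇒nonZero B
      posB⁻¹ : ℚ.Positive (ℚ.1/ B)
      posB⁻¹ = ℚₚ.1/pos⇒pos B
    δ = ℚ.1/ B ℚ.* ε
    0<δ : 0ℚ ℚ.< δ
    0<δ = ℚₚ.positive⁻¹ δ {{ℚₚ.pos*pos⇒pos (ℚ.1/ B) ε}}
    B*δ≡ε : B ℚ.* δ ≡ ε
    B*δ≡ε = trans (sym (ℚₚ.*-assoc B (ℚ.1/ B) ε))
                  (trans (cong (ℚ._* ε) (ℚₚ.*-inverseʳ B)) (ℚₚ.*-identityˡ ε))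

  ∣*∣-mono : ∀ {p q b d} → ℚ.∣ p ∣ ℚ.≤ b → ℚ.∣ q ∣ ℚ.≤ d → ℚ.∣ p ℚ.* q ∣ ℚ.≤ b ℚ.* d
  ∣*∣-mono {p} {q} {b} {d} p≤b q≤d = begin
    ℚ.∣ p ℚ.* q ∣
      ≡⟨ ℚₚ.∣p*q∣≡∣p∣*∣q∣ p q ⟩
    ℚ.∣ p ∣ ℚ.* ℚ.∣ q ∣
      ≤⟨ ℚₚ.*-monoʳ-≤-nonNeg ℚ.∣ q ∣ {{ℚₚ.∣-∣-nonNeg q}} p≤b ⟩
    b ℚ.* ℚ.∣ q ∣
      ≤⟨ ℚₚ.*-monoˡ-≤-nonNeg b {{ℚ.nonNegative (ℚₚ.≤-trans (ℚₚ.0≤∣p∣ p) p≤b)}} q≤d ⟩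
    b ℚ.* d ∎
    where open ℚₚ.≤-Reasoning

  *-close : ∀ p q p′ q′ {b c d η ε} → b ℚ.* d ≡ ½ ℚ.* ε → c ℚ.* η ≡ ½ ℚ.* ε →
            ℚ.∣ p ∣ ℚ.≤ b → ℚ.∣ q′ ∣ ℚ.≤ c →
            ℚ.∣ q ℚ.- q′ ∣ ℚ.≤ d → ℚ.∣ p ℚ.- p′ ∣ ℚ.≤ η →
            ℚ.∣ p ℚ.* q ℚ.- p′ ℚ.* q′ ∣ ℚ.≤ ε
  *-close p q p′ q′ {b} {c} {d} {η} {ε} bd cη p≤b q′≤c q≈q′ p≈p′ = begin
    ℚ.∣ p ℚ.* q ℚ.- p′ ℚ.* q′ ∣
      ≡⟨ cong ℚ.∣_∣ (rearrange p q p′ q′) ⟩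
    ℚ.∣ p ℚ.* (q ℚ.- q′) ℚ.+ q′ ℚ.* (p ℚ.- p′) ∣
      ≤⟨ ℚₚ.∣p+q∣≤∣p∣+∣q∣ (p ℚ.* (q ℚ.- q′)) (q′ ℚ.* (p ℚ.- p′)) ⟩
    ℚ.∣ p ℚ.* (q ℚ.- q′) ∣ ℚ.+ ℚ.∣ q′ ℚ.* (p ℚ.- p′) ∣
      ≤⟨ ℚₚ.+-mono-≤ (∣*∣-mono {p} {q ℚ.- q′} p≤b q≈q′) (∣*∣-mono {q′} {p ℚ.- p′} q′≤c p≈p′) ⟩
    b ℚ.* d ℚ.+ c ℚ.* η
      ≡⟨ cong₂ ℚ._+_ bd cη ⟩
    ½ ℚ.* ε ℚ.+ ½ ℚ.* ε
      ≡⟨ half+half ε ⟩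
    ε ∎
    where
    open ℚₚ.≤-Reasoning
    open +-*-Solver
    rearrange : ∀ a b c d →
      a ℚ.* b ℚ.- c ℚ.* d ≡ a ℚ.* (b ℚ.- d) ℚ.+ d ℚ.* (a ℚ.- c)
    rearrange = solve 4 (λ a b c d →
      a :* b :- c :* d := a :* (b :- d) :+ d :* (a :- c)) refl

  *-cauchy : ∀ {s t} → IsCauchy s → IsCauchy t → IsCauchy (λ n → s n ℚ.* t n)
  *-cauchy {s} {t} cs ct ε 0<ε =
    let B , 0<B , K , s≤B = eventually-bounded {s} cs
        C , 0<C , L , t≤C = eventually-bounded {t} ct
        d , 0<d , Bd = divide B (½ ℚ.* ε) 0<B (half-pos 0<ε)
        η , 0<η , Cη = divide C (½ ℚ.* ε) 0<C (half-pos 0<ε)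
        M , closeₜ = ct d 0<d
        N , closeₛ = cs η 0<η
        KL = K ℕ.⊔ L
        MN = M ℕ.⊔ N
    in KL ℕ.⊔ MN , λ m n ≤m ≤n →
      *-close (s m) (t m) (s n) (t n) Bd Cη
        (s≤B m (ℕₚ.m⊔n≤o⇒m≤o K L (ℕₚ.m⊔n≤o⇒m≤o KL MN ≤m)))
        (t≤C n (ℕₚ.m⊔n≤o⇒n≤o K L (ℕₚ.m⊔n≤o⇒m≤o KL MN ≤n)))
        (closeₜ m n (ℕₚ.m⊔n≤o⇒m≤o M N (ℕₚ.m⊔n≤o⇒n≤o KL MN ≤m))
                    (ℕₚ.m⊔n≤o⇒m≤o M N (ℕₚ.m⊔n≤o⇒n≤o KL MN ≤n)))
        (closeₛ m n (ℕₚ.m⊔n≤o⇒n≤o M N (ℕₚ.m⊔n≤o⇒n≤o KL MN ≤m))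
                    (ℕₚ.m⊔n≤o⇒n≤o M N (ℕₚ.m⊔n≤o⇒n≤o KL MN ≤n)))

open CauchyLemmas

infixl 6 _+ᵣ_ _-ᵣ_
infixl 7 _*ᵣ_
infix  8 -ᵣ_

_+ᵣ_ : ℝ → ℝ → ℝ
x +ᵣ y = mkℝ (λ n → seq x n ℚ.+ seq y n) (+-cauchy {seq x} {seq y} (cauchy x) (cauchy y))

_*ᵣ_ : ℝ → ℝ → ℝ
x *ᵣ y = mkℝ (λ n → seq x n ℚ.* seq y n) (*-cauchy {seq x} {seq y} (cauchy x) (cauchy y))

-ᵣ_ : ℝ → ℝ
-ᵣ x = mkℝ (λ n → ℚ.- seq x n) (neg-cauchy {seq x} (cauchy x))

_-ᵣ_ : ℝ → ℝ → ℝ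
x -ᵣ y = x +ᵣ (-ᵣ y)

fromℚ : ℚ → ℝ
fromℚ q = mkℝ (λ _ → q) (const-cauchy q)

fromℤ : ℤ → ℝ
fromℤ z = fromℚ (z ℚ./ 1)

0ᵣ 1ᵣ : ℝ
0ᵣ = fromℚ 0ℚ
1ᵣ = fromℚ 1ℚ

+ᵣ-rawMonoid : RawMonoid 0ℓ 0ℓ
+ᵣ-rawMonoid = record { Carrier = ℝ ; _≈_ = _≈ᵣ_ ; _∙_ = _+ᵣ_ ; ε = 0ᵣ }

open RawMonoidDefs +ᵣ-rawMonoid public using () renaming (sum to sumᵣ)

------------------------------------------------------------------------
-- Subsets of a subset U of Fin n.  The proof of inclusion is irrelevant,
-- so functions on 2^ U depend only on the underlying subset.

Elem : {n : ℕ} → Subset n → Set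
Elem {n} U = [ v ∈ Fin n ∣ v ∈ U ]

2^_ : {n : ℕ} → Subset n → Set
2^_ {n} U = [ S ∈ Subset n ∣ S ⊆ U ]

module _ {n : ℕ} {U : Subset n} where

  infixr 7 _⊓_
  infixr 6 _⊔_
  infixl 5 _∖_

  ∅ full : 2^ U
  ∅    = Subset.⊥ , [ ⊆-min U ]
  full = U , [ ⊆-refl ]

  _⊓_ _⊔_ _∖_ : 2^ U → 2^ U → 2^ U
  (A , [ A⊆U ]) ⊓ (B , _) = A ∩ B , [ A⊆U ∘ p∩q⊆p A B ]
  (A , [ A⊆U ]) ⊔ (B , [ B⊆U ]) = A ∪ B , [ [ A⊆U , B⊆U ]′ ∘ x∈p∪q⁻ A B ]
  (A , [ A⊆U ]) ∖ (B , _) = A ─ B , [ A⊆U ∘ p─q⊆p A B ]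

  WeaklySupermodular : (2^ U → ℤ) → Set
  WeaklySupermodular h = ∀ A B →
    h A ℤ.+ h B ℤ.≤ (h (A ⊓ B) ℤ.+ h (A ⊔ B)) ℤ.⊔ (h (A ∖ B) ℤ.+ h (B ∖ A))

  Symmetric : (2^ U → ℤ) → Set
  Symmetric h = ∀ S → h S ≡ h (full ∖ S)

  Normalized : (2^ U → ℤ) → Set
  Normalized h = h ∅ ≡ ℤ.0ℤ × h full ≡ ℤ.0ℤ

  record IsPartition {k : ℕ} (P : Fin k → 2^ U) : Set where
    field
      nonempty : ∀ i → Nonempty (value (P i))
      disjoint : ∀ i j → i ≢ j → Empty (value (P i) ∩ value (P j))
      covers   : ∀ v → v ∈ U → ∃[ i ] v ∈ value (P i)

------------------------------------------------------------------------
-- Finite undirected graphs with vertices labelled in Fin n and edges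
-- labelled in Fin m; parallel edges and loops are allowed.  The order of
-- the two ends is immaterial in everything below, and the values of ends
-- at labels outside E never matter.

record Graph (n m : ℕ) : Set where
  field
    V        : Subset n
    E        : Subset m
    ends     : Fin m → Fin n × Fin n
    incident : ∀ {e} → e ∈ E → proj₁ (ends e) ∈ V × proj₂ (ends e) ∈ V
open Graph public

module _ {n m : ℕ} where

  crossing : (Fin m → Fin n × Fin n) → Subset n → Subset m
  crossing ends S = tabulate λ e →
    lookup S (proj₁ (ends e)) xor lookup S (proj₂ (ends e))

  inner : (Fin m → Fin n × Fin n) → Subset n → Subset m
  inner ends S = tabulate λ e →
    lookup S (proj₁ (ends e)) ∧ lookup S (proj₂ (ends e))

  ∈-inner : ∀ ends S {e} → e ∈ inner ends S →
            proj₁ (ends e) ∈ S × proj₂ (ends e) ∈ S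
  ∈-inner ends S {e} e∈ = split refl refl
    where
    both : lookup S (proj₁ (ends e)) ∧ lookup S (proj₂ (ends e)) ≡ true
    both = trans (sym (lookup∘tabulate _ e)) ([]=⇒lookup e∈)
    split : ∀ {a b} → lookup S (proj₁ (ends e)) ≡ a → lookup S (proj₂ (ends e)) ≡ b →
            proj₁ (ends e) ∈ S × proj₂ (ends e) ∈ S
    split {true}  {true}  p q = lookup⇒[]= _ S p , lookup⇒[]= _ S q
    split {true}  {false} p q with () ← trans (sym both) (cong₂ _∧_ p q)
    split {false} {_}     p q with () ← trans (sym both) (cong₂ _∧_ p q)

  δ : (D : Graph n m) → 2^ V D → 2^ E D
  δ D (S , _) = E D ∩ crossing (ends D) S , [ p∩q⊆p (E D) (crossing (ends D) S) ]

  infix 9 _⟨_⟩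

  -- The induced subgraph D[S].
  _⟨_⟩ : (D : Graph n m) → 2^ V D → Graph n m
  D ⟨ S , _ ⟩ = record
    { V        = S
    ; E        = E D ∩ inner (ends D) S
    ; ends     = ends D
    ; incident = λ e∈ → ∈-inner (ends D) S (proj₂ (x∈p∩q⁻ (E D) _ e∈))
    }

  module _ (D : Graph n m) where

    -- Z(S), as a set of edges of D[S].
    edgesWithin : 2^ E D → (S : 2^ V D) → 2^ E (D ⟨ S ⟩)
    edgesWithin (Z , [ Z⊆E ]) (S , _) = Z ∩ inner (ends D) S ,
      [ (λ e∈ → let e∈Z , e∈S = x∈p∩q⁻ Z (inner (ends D) S) e∈
                in x∈p∩q⁺ (Z⊆E e∈Z , e∈S)) ]

    EdgeVector : Set
    EdgeVector = Elem (E D) → ℝ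

    -- x(Z), the sum of the entries of x over Z.
    total : EdgeVector → 2^ E D → ℝ
    total x (Z , [ Z⊆E ]) = sumᵣ term
      where
      term : Fin m → ℝ
      term e with e ∈? Z
      ... | yes e∈Z = x (e , [ Z⊆E e∈Z ])
      ... | no  _   = 0ᵣ

    -- The restriction x^S.
    restrict : EdgeVector → (S : 2^ V D) → Elem (E (D ⟨ S ⟩)) → ℝ
    restrict x (S , _) e = x (Refinement.refine (p∩q⊆p (E D) (inner (ends D) S)) e)

  module _ (D : Graph n m) (h : 2^ V D → ℤ) where

    crBound : 2^ V D → ℤ
    crBound S = h S ℤ.⊓ + ∣ value (δ D S) ∣

    FeasibleNDP : 2^ E D → Set
    FeasibleNDP H = ∀ S → h S ℤ.≤ + ∣ value (δ D S ⊓ H) ∣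

    FeasibleCRNDP : 2^ E D → Set
    FeasibleCRNDP H = ∀ S → crBound S ℤ.≤ + ∣ value (δ D S ⊓ H) ∣

    RegionNDP : EdgeVector D → Set
    RegionNDP x = (∀ S → fromℤ (h S) ≤ᵣ total D x (δ D S))
                × (∀ e → 0ᵣ ≤ᵣ x e × x e ≤ᵣ 1ᵣ)

    RegionCRLP : EdgeVector D → Set
    RegionCRLP x = (∀ S → fromℤ (crBound S) ≤ᵣ total D x (δ D S))
                 × (∀ e → 0ᵣ ≤ᵣ x e × x e ≤ᵣ 1ᵣ)

-- x lies in Q and is not a proper convex combination of two points of Q
-- other than x itself.
ExtremePoint : ∀ {I : Set} → ((I → ℝ) → Set) → (I → ℝ) → Set
ExtremePoint {I} Q x = Q x ×
  (∀ (y z : I → ℝ) (t : ℝ) → Q y → Q z → 0ᵣ <ᵣ t → t <ᵣ 1ᵣ →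
    (∀ e → x e ≈ᵣ t *ᵣ y e +ᵣ (1ᵣ -ᵣ t) *ᵣ z e) →
    (∀ e → y e ≈ᵣ x e) × (∀ e → z e ≈ᵣ x e))

{-# OPTIONS --safe #-}
module Submission where

-- Let d(S) = |δ(S)| and g = f - d. As d is submodular and posimodular, g is
-- weakly supermodular, and with w = 1 - x the constraints of (CRLP) read
-- w(δ(S)) ≤ max(0, -g(S)). If g ≤ 0 throughout, they are those of (NDP) and
-- nothing is to be done. Otherwise let A maximise g. Then g(A) > 0 forces w = 0
-- on δ(A), and uncrossing any S with A bounds g(A) + g(S) by g(A ∩ S) + g(A ∪ S)
-- or by g(A - S) + g(S - A); since g(A) is maximal, the constraint for S follows
-- from constraints for subsets of A and of V - A. So the system splits into one
-- on A and one on V - A, where the new requirement on A at a proper subset X is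
-- the larger of f(X) - c(X) and f(A - X) - c(A - X), c(X) being the number of
-- edges between X and V - A, and 0 on ∅ and A. Iterate on both halves.
-- Part (a) is (b) for the characteristic vector of F, and (c) follows from (b)
-- by completing a point of one factor with the remaining coordinates of x.

open import Defs
open CauchyLemmas
open import Data.Bool.Base using (Bool; true; false; if_then_else_; _∧_; _∨_; _xor_; not; T)
open import Data.Bool.Properties using (T-≡; T-∧; ∧-identityʳ)
import Data.Bool.Properties as Bool
open import Data.Fin.Base using (Fin; zero; suc)
import Data.Fin.Properties as Finₚ
open import Data.Fin.Subset using (Subset; ⊥; _∈_; _∉_; _⊆_; _⊂_; _∩_; _∪_; _─_; ∣_∣; Nonempty; Empty)
open import Data.Fin.Subset.Properties
import Data.Integer as ℤ
open ℤ using (ℤ; +_; 0ℤ)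
import Data.Integer.Properties as ℤₚ
import Data.Integer.Solver as ℤ-Solver
open import Data.Irrelevant using ([_])
open import Data.List.Base using (List; []; _∷_)
open import Data.List.Relation.Unary.All using (All; []; _∷_)
open import Data.Nat.Base as ℕ using (ℕ; zero; suc)
open import Data.Nat.Induction using (<-wellFounded)
import Data.Nat.Properties as ℕₚ
import Data.Nat.Solver as ℕ-Solver
open import Data.Product.Base using (_×_; _,_; proj₁; proj₂; ∃-syntax; Σ-syntax)
open import Data.Rational as ℚ using (ℚ; 0ℚ; 1ℚ; ½)
import Data.Rational.Properties as ℚₚ
import Data.Rational.Solver as ℚ-Solver
import Data.Rational.Unnormalised.Base as ℚᵘ
import Data.Rational.Unnormalised.Properties as ℚᵘₚ
open import Data.Refinement as Refinement using (value; _,_)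
open import Data.Refinement.Properties using (value-injective)
open import Data.Sum.Base as Sum using (_⊎_; inj₁; inj₂)
open import Data.Sum.Function.Propositional using (_⊎-↔_)
open import Data.Vec.Base using (Vec; []; _∷_; lookup; map)
open import Data.Vec.Properties
  using (lookup-zipWith; lookup-map; lookup-replicate; lookup∘tabulate; []=⇒lookup; lookup⇒[]=;
         map-cong; ≡-dec)
open import Function.Base using (_∘_)
open import Function.Bundles using (_⇔_; _↔_; mk⇔; module Equivalence; module Inverse)
open import Function.Construct.Composition using (_↔-∘_)
open import Function.Construct.Identity using (↔-id)
open import Induction.WellFounded using (Acc; acc)
open import Relation.Binary.PropositionalEquality
open import Relation.Nullary using (Dec; yes; no; ¬_; contradiction; contradiction-irr)
open import Relation.Nullary.Decidable using (_⊎-dec_; recompute)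

-- The order on Cauchy reals is not decidable, so every case distinction concerns sets, truth values
-- or integers: minima and maxima are taken in the integers and only then embedded. In terms of `w`
-- all constraints become upper bounds on nonnegative sums, so passing to a smaller cut preserves
-- them.
--
-- The shape of the new requirement on `A` is dictated by uncrossing. Discounting by `c` treats the
-- edges leaving `A` as bought, but `f` is symmetric under complements in `V`, not in `A`, so
-- `f - c` need not be symmetric. Uncrossing may also return `A ∪ S`, whose complement in `V` is the
-- complement of `S` within `V - A`, although the cut to be bounded there is that of the trace of
-- `S`. Taking the larger value over a set and its complement repairs both. At `A` itself `f - c`
-- equals `g(A) > 0`, while the cut of `A` in its own subgraph is empty, so this value has to be
-- reset to 0. The remaining obstacle is that such a reset might destroy weak supermodularity;
-- symmetry prevents that.

private variable
  n m k j : ℕ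

-- Order and sums of real numbers

infix 4 _≲_

-- A record, so that x and y can be inferred from a proof of x ≲ y.
record _≲_ (x y : ℝ) : Set where
  constructor ⌜_⌝
  field ⌞_⌟ : x ≤ᵣ y
open _≲_ public

pointwise⇒≲ : ∀ {x y} → (∀ n → seq x n ℚ.≤ seq y n) → x ≲ y
pointwise⇒≲ {x} {y} x≤y = ⌜ (λ ε 0<ε → 0 , λ n _ → begin
  seq x n            ≤⟨ x≤y n ⟩
  seq y n            ≡⟨ ℚₚ.+-identityʳ (seq y n) ⟨
  seq y n ℚ.+ 0ℚ     ≤⟨ ℚₚ.+-monoʳ-≤ (seq y n) (ℚₚ.<⇒≤ 0<ε) ⟩
  seq y n ℚ.+ ε      ∎) ⌝
  where open ℚₚ.≤-Reasoning

pointwise≡⇒≲ : ∀ {x y} → (∀ n → seq x n ≡ seq y n) → x ≲ y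
pointwise≡⇒≲ x≡y = pointwise⇒≲ (λ n → ℚₚ.≤-reflexive (x≡y n))

≲-refl : ∀ {x} → x ≲ x
≲-refl = pointwise⇒≲ (λ _ → ℚₚ.≤-refl)

≲-trans : ∀ {x y z} → x ≲ y → y ≲ z → x ≲ z
≲-trans {x} {y} {z} ⌜ x≤y ⌝ ⌜ y≤z ⌝ = ⌜ (λ ε 0<ε →
  let M , x≤ = x≤y (½ ℚ.* ε) (half-pos 0<ε)
      N , y≤ = y≤z (½ ℚ.* ε) (half-pos 0<ε)
  in M ℕ.⊔ N , λ n ≤n → begin
    seq x n
      ≤⟨ x≤ n (ℕₚ.m⊔n≤o⇒m≤o M N ≤n) ⟩
    seq y n ℚ.+ ½ ℚ.* ε
      ≤⟨ ℚₚ.+-monoˡ-≤ (½ ℚ.* ε) (y≤ n (ℕₚ.m⊔n≤o⇒n≤o M N ≤n)) ⟩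
    seq z n ℚ.+ ½ ℚ.* ε ℚ.+ ½ ℚ.* ε
      ≡⟨ ℚₚ.+-assoc (seq z n) (½ ℚ.* ε) (½ ℚ.* ε) ⟩
    seq z n ℚ.+ (½ ℚ.* ε ℚ.+ ½ ℚ.* ε)
      ≡⟨ cong (seq z n ℚ.+_) (half+half ε) ⟩
    seq z n ℚ.+ ε ∎) ⌝
  where open ℚₚ.≤-Reasoning

infixl 6 _⊕_

opaque

  -- Opaque because comparing unfolded sums of Cauchy sequences is intractable.
  _⊕_ : ℝ → ℝ → ℝ
  x ⊕ y = x +ᵣ y

  ∑ : ∀ {m} → (Fin m → ℝ) → ℝ
  ∑ f = sumᵣ f

  complement : ℝ → ℝ
  complement x = 1ᵣ -ᵣ x

opaque
  unfolding _⊕_ ∑ complement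

  seq-complement : ∀ x n → seq (complement x) n ≡ 1ℚ ℚ.- seq x n
  seq-complement x n = refl

  seq-⊕ : ∀ x y n → seq (x ⊕ y) n ≡ seq x n ℚ.+ seq y n
  seq-⊕ x y n = refl

  seq-∑-zero : (f : Fin 0 → ℝ) → ∀ n → seq (∑ f) n ≡ 0ℚ
  seq-∑-zero f n = refl

  seq-∑-suc : ∀ {m} (f : Fin (suc m) → ℝ) n →
    seq (∑ f) n ≡ seq (f zero) n ℚ.+ seq (∑ (λ e → f (suc e))) n
  seq-∑-suc f n = refl

⊕-mono-≲ : ∀ {x y z w} → x ≲ y → z ≲ w → x ⊕ z ≲ y ⊕ w
⊕-mono-≲ {x} {y} {z} {w} ⌜ x≤y ⌝ ⌜ z≤w ⌝ = ⌜ (λ ε 0<ε →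
  let M , x≤ = x≤y (½ ℚ.* ε) (half-pos 0<ε)
      N , z≤ = z≤w (½ ℚ.* ε) (half-pos 0<ε)
  in M ℕ.⊔ N , λ n ≤n → begin
    seq (x ⊕ z) n
      ≡⟨ seq-⊕ x z n ⟩
    seq x n ℚ.+ seq z n
      ≤⟨ ℚₚ.+-mono-≤ (x≤ n (ℕₚ.m⊔n≤o⇒m≤o M N ≤n)) (z≤ n (ℕₚ.m⊔n≤o⇒n≤o M N ≤n)) ⟩
    (seq y n ℚ.+ ½ ℚ.* ε) ℚ.+ (seq w n ℚ.+ ½ ℚ.* ε)
      ≡⟨ solve 3 (λ a b c → (a :+ c) :+ (b :+ c) := (a :+ b) :+ (c :+ c)) refl
           (seq y n) (seq w n) (½ ℚ.* ε) ⟩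
    (seq y n ℚ.+ seq w n) ℚ.+ (½ ℚ.* ε ℚ.+ ½ ℚ.* ε)
      ≡⟨ cong₂ ℚ._+_ (sym (seq-⊕ y w n)) (half+half ε) ⟩
    seq (y ⊕ w) n ℚ.+ ε ∎) ⌝
  where
  open ℚₚ.≤-Reasoning
  open ℚ-Solver.+-*-Solver

p-q≤r⇒p≤q+r : ∀ {p q r} → p ℚ.- q ℚ.≤ r → p ℚ.≤ q ℚ.+ r
p-q≤r⇒p≤q+r {p} {q} {r} p-q≤r = begin
  p                   ≡⟨ solve 2 (λ p q → p := q :+ (p :- q)) refl p q ⟩
  q ℚ.+ (p ℚ.- q)     ≤⟨ ℚₚ.+-monoʳ-≤ q p-q≤r ⟩
  q ℚ.+ r             ∎
  where
  open ℚₚ.≤-Reasoning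
  open ℚ-Solver.+-*-Solver

p≤q+r⇒p-q≤r : ∀ {p q r} → p ℚ.≤ q ℚ.+ r → p ℚ.- q ℚ.≤ r
p≤q+r⇒p-q≤r {p} {q} {r} p≤q+r = begin
  p ℚ.- q             ≤⟨ ℚₚ.+-monoˡ-≤ (ℚ.- q) p≤q+r ⟩
  q ℚ.+ r ℚ.- q       ≡⟨ solve 2 (λ q r → q :+ r :- q := r) refl q r ⟩
  r                   ∎
  where
  open ℚₚ.≤-Reasoning
  open ℚ-Solver.+-*-Solver

-‿anti-≲ : ∀ {x y} → x ≲ y → -ᵣ y ≲ -ᵣ x
-‿anti-≲ {x} {y} ⌜ x≤y ⌝ = ⌜ (λ ε 0<ε →
  let N , x≤ = x≤y ε 0<ε
  in N , λ n ≤n → p-q≤r⇒p≤q+r (begin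
    ℚ.- seq y n ℚ.- (ℚ.- seq x n)
      ≡⟨ solve 2 (λ x y → :- y :- (:- x) := x :- y) refl (seq x n) (seq y n) ⟩
    seq x n ℚ.- seq y n
      ≤⟨ p≤q+r⇒p-q≤r (x≤ n ≤n) ⟩
    ε ∎)) ⌝
  where
  open ℚₚ.≤-Reasoning
  open ℚ-Solver.+-*-Solver

p≤∣p∣ : ∀ p → p ℚ.≤ ℚ.∣ p ∣
p≤∣p∣ p with ℚₚ.≤-total 0ℚ p
... | inj₁ 0≤p = ℚₚ.≤-reflexive (sym (ℚₚ.0≤p⇒∣p∣≡p 0≤p))
... | inj₂ p≤0 = ℚₚ.≤-trans p≤0 (ℚₚ.0≤∣p∣ p)

∣p-q∣≡∣q-p∣ : ∀ p q → ℚ.∣ p ℚ.- q ∣ ≡ ℚ.∣ q ℚ.- p ∣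
∣p-q∣≡∣q-p∣ p q = trans (sym (ℚₚ.∣-p∣≡∣p∣ (p ℚ.- q)))
  (cong ℚ.∣_∣ (solve 2 (λ p q → :- (p :- q) := q :- p) refl p q))
  where open ℚ-Solver.+-*-Solver

≈-sym : ∀ {x y} → x ≈ᵣ y → y ≈ᵣ x
≈-sym {x} {y} x≈y ε 0<ε =
  let N , close = x≈y ε 0<ε
  in N , λ n ≤n → subst (ℚ._≤ ε) (∣p-q∣≡∣q-p∣ (seq x n) (seq y n)) (close n ≤n)

≈⇒≲ : ∀ {x y} → x ≈ᵣ y → x ≲ y
≈⇒≲ {x} {y} x≈y = ⌜ (λ ε 0<ε →
  let N , close = x≈y ε 0<ε
  in N , λ n ≤n → p-q≤r⇒p≤q+r
       (ℚₚ.≤-trans (p≤∣p∣ (seq x n ℚ.- seq y n)) (close n ≤n))) ⌝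

≈⇒≳ : ∀ {x y} → x ≈ᵣ y → y ≲ x
≈⇒≳ {x} {y} x≈y = ≈⇒≲ (≈-sym {x} {y} x≈y)

∣p∣≤ : ∀ {p ε} → p ℚ.≤ ε → ℚ.- p ℚ.≤ ε → ℚ.∣ p ∣ ℚ.≤ ε
∣p∣≤ {p} p≤ε -p≤ε with ℚₚ.∣p∣≡p∨∣p∣≡-p p
... | inj₁ eq = subst (ℚ._≤ _) (sym eq) p≤ε
... | inj₂ eq = subst (ℚ._≤ _) (sym eq) -p≤ε

≲-antisym : ∀ {x y} → x ≲ y → y ≲ x → x ≈ᵣ y
≲-antisym {x} {y} ⌜ x≤y ⌝ ⌜ y≤x ⌝ ε 0<ε =
  let M , x≤ = x≤y ε 0<ε
      N , y≤ = y≤x ε 0<ε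
  in M ℕ.⊔ N , λ n ≤n → ∣p∣≤
    (p≤q+r⇒p-q≤r (x≤ n (ℕₚ.m⊔n≤o⇒m≤o M N ≤n)))
    (ℚₚ.≤-trans
      (ℚₚ.≤-reflexive (solve 2 (λ p q → :- (p :- q) := q :- p) refl (seq x n) (seq y n)))
      (p≤q+r⇒p-q≤r (y≤ n (ℕₚ.m⊔n≤o⇒n≤o M N ≤n))))
  where open ℚ-Solver.+-*-Solver

-- In unnormalised fractions no gcd has to be computed: the numerator is `z` itself, and the
-- argument 0 is the denominator minus one.
toℚᵘ-/1 : ∀ z → ℚ.toℚᵘ (z ℚ./ 1) ℚᵘ.≃ ℚᵘ.mkℚᵘ z 0
toℚᵘ-/1 z = ℚₚ.toℚᵘ-fromℚᵘ (ℚᵘ.mkℚᵘ z 0)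

/1-mono : ∀ {a b} → a ℤ.≤ b → a ℚ./ 1 ℚ.≤ b ℚ./ 1
/1-mono {a} {b} a≤b = ℚₚ.toℚᵘ-cancel-≤ (begin
  ℚ.toℚᵘ (a ℚ./ 1)   ≃⟨ toℚᵘ-/1 a ⟩
  ℚᵘ.mkℚᵘ a 0        ≤⟨ ℚᵘ.*≤* (ℤₚ.*-monoʳ-≤-nonNeg (+ 1) a≤b) ⟩
  ℚᵘ.mkℚᵘ b 0        ≃⟨ toℚᵘ-/1 b ⟨
  ℚ.toℚᵘ (b ℚ./ 1)   ∎)
  where open ℚᵘₚ.≤-Reasoning

/1-cancel : ∀ {a b} → a ℚ./ 1 ℚ.≤ b ℚ./ 1 → a ℤ.≤ b
/1-cancel {a} {b} a≤b = subst₂ ℤ._≤_ (ℤₚ.*-identityʳ a) (ℤₚ.*-identityʳ b)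
  (ℚᵘₚ.drop-*≤* (begin
    ℚᵘ.mkℚᵘ a 0        ≃⟨ toℚᵘ-/1 a ⟨
    ℚ.toℚᵘ (a ℚ./ 1)   ≤⟨ ℚₚ.toℚᵘ-mono-≤ a≤b ⟩
    ℚ.toℚᵘ (b ℚ./ 1)   ≃⟨ toℚᵘ-/1 b ⟩
    ℚᵘ.mkℚᵘ b 0        ∎))
  where open ℚᵘₚ.≤-Reasoning

/1-homo-+ : ∀ a b → (a ℤ.+ b) ℚ./ 1 ≡ a ℚ./ 1 ℚ.+ b ℚ./ 1
/1-homo-+ a b = ℚₚ.toℚᵘ-injective (begin-equality
  ℚ.toℚᵘ ((a ℤ.+ b) ℚ./ 1)
    ≃⟨ toℚᵘ-/1 (a ℤ.+ b) ⟩
  ℚᵘ.mkℚᵘ (a ℤ.+ b) 0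
    ≃⟨ ℚᵘ.*≡* (cong (ℤ._* + 1) (cong₂ ℤ._+_ (sym (ℤₚ.*-identityʳ a)) (sym (ℤₚ.*-identityʳ b)))) ⟩
  ℚᵘ.mkℚᵘ a 0 ℚᵘ.+ ℚᵘ.mkℚᵘ b 0
    ≃⟨ ℚᵘₚ.+-cong (toℚᵘ-/1 a) (toℚᵘ-/1 b) ⟨
  ℚ.toℚᵘ (a ℚ./ 1) ℚᵘ.+ ℚ.toℚᵘ (b ℚ./ 1)
    ≃⟨ ℚₚ.toℚᵘ-homo-+ (a ℚ./ 1) (b ℚ./ 1) ⟨
  ℚ.toℚᵘ (a ℚ./ 1 ℚ.+ b ℚ./ 1) ∎)
  where open ℚᵘₚ.≤-Reasoning

fromℤ-mono : ∀ {a b} → a ℤ.≤ b → fromℤ a ≲ fromℤ b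
fromℤ-mono a≤b = pointwise⇒≲ (λ _ → /1-mono a≤b)

-- Both sequences are constant, so if `b` were smaller than `a`, a tolerance of half the gap would
-- already be violated at every index.
fromℤ-cancel : ∀ {a b} → fromℤ a ≲ fromℤ b → a ℤ.≤ b
fromℤ-cancel {a} {b} ⌜ a≤b ⌝ = /1-cancel (ℚₚ.≮⇒≥ λ b<a →
  let d      = a ℚ./ 1 ℚ.- b ℚ./ 1
      0<d    = subst (ℚ._< d) (ℚₚ.+-inverseʳ (b ℚ./ 1)) (ℚₚ.+-monoˡ-< (ℚ.- (b ℚ./ 1)) b<a)
      N , a≤ = a≤b (½ ℚ.* d) (half-pos 0<d)
      d≤½d   = p≤q+r⇒p-q≤r {q = b ℚ./ 1} (a≤ N ℕₚ.≤-refl)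
      ½d<d   = subst₂ ℚ._<_ (ℚₚ.+-identityʳ (½ ℚ.* d)) (half+half d)
                 (ℚₚ.+-monoʳ-< (½ ℚ.* d) (half-pos 0<d))
  in ℚₚ.<-irrefl refl (ℚₚ.<-≤-trans ½d<d d≤½d))

fromℤ-homo-≲ : ∀ a b → fromℤ (a ℤ.+ b) ≲ fromℤ a ⊕ fromℤ b
fromℤ-homo-≲ a b = pointwise≡⇒≲ (λ n → trans (/1-homo-+ a b) (sym (seq-⊕ (fromℤ a) (fromℤ b) n)))

fromℤ-homo-≳ : ∀ a b → fromℤ a ⊕ fromℤ b ≲ fromℤ (a ℤ.+ b)
fromℤ-homo-≳ a b = pointwise≡⇒≲ (λ n → trans (seq-⊕ (fromℤ a) (fromℤ b) n) (sym (/1-homo-+ a b)))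

⊕-comm-≲ : ∀ x y → x ⊕ y ≲ y ⊕ x
⊕-comm-≲ x y = pointwise≡⇒≲ (λ n →
  trans (seq-⊕ x y n) (trans (ℚₚ.+-comm (seq x n) (seq y n)) (sym (seq-⊕ y x n))))

-- Add `- x ≲ - z` to the hypothesis. All exchanges between lower bounds on `x` and upper bounds on
-- `1 - x` go through this step.
⊕-cancelˡ-≲ : ∀ {x y z w} → x ⊕ y ≲ z ⊕ w → z ≲ x → y ≲ w
⊕-cancelˡ-≲ {x} {y} {z} {w} x+y≲z+w z≲x = ≲-trans
  (pointwise≡⇒≲ (λ n → sym (cancel x y n)))
  (≲-trans (⊕-mono-≲ x+y≲z+w (-‿anti-≲ z≲x)) (pointwise≡⇒≲ (cancel z w)))
  where
  cancel : ∀ x y n → seq ((x ⊕ y) ⊕ (-ᵣ x)) n ≡ seq y n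
  cancel x y n = trans (seq-⊕ (x ⊕ y) (-ᵣ x) n) (trans (cong (ℚ._- seq x n) (seq-⊕ x y n))
    (solve 2 (λ a b → (a :+ b) :- a := b) refl (seq x n) (seq y n)))
    where open ℚ-Solver.+-*-Solver

0⊕ : ∀ x n → seq (0ᵣ ⊕ x) n ≡ seq x n
0⊕ x n = trans (seq-⊕ 0ᵣ x n) (ℚₚ.+-identityˡ (seq x n))

y≲x⊕y : ∀ x y → 0ᵣ ≲ x → y ≲ x ⊕ y
y≲x⊕y x y 0≲x = ≲-trans (pointwise≡⇒≲ (λ n → sym (0⊕ y n))) (⊕-mono-≲ 0≲x ≲-refl)

x≲x⊕y : ∀ x y → 0ᵣ ≲ y → x ≲ x ⊕ y
x≲x⊕y x y 0≲y = ≲-trans (y≲x⊕y y x 0≲y) (⊕-comm-≲ y x)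

∑-suc-≲ : ∀ {m} (f : Fin (suc m) → ℝ) → ∑ f ≲ f zero ⊕ ∑ (λ e → f (suc e))
∑-suc-≲ f = pointwise≡⇒≲ (λ n → trans (seq-∑-suc f n) (sym (seq-⊕ _ _ n)))

∑-suc-≳ : ∀ {m} (f : Fin (suc m) → ℝ) → f zero ⊕ ∑ (λ e → f (suc e)) ≲ ∑ f
∑-suc-≳ f = pointwise≡⇒≲ (λ n → trans (seq-⊕ _ _ n) (sym (seq-∑-suc f n)))

∑-mono : ∀ {m} {f g : Fin m → ℝ} → (∀ e → f e ≲ g e) → ∑ f ≲ ∑ g
∑-mono {zero}  {f} {g} f≲g = pointwise≡⇒≲ (λ n → trans (seq-∑-zero f n) (sym (seq-∑-zero g n)))
∑-mono {suc m} {f} {g} f≲g = ≲-trans (∑-suc-≲ f) (≲-trans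
  (⊕-mono-≲ (f≲g zero) (∑-mono (λ e → f≲g (suc e))))
  (∑-suc-≳ g))

seq-∑-+ : ∀ {m} (f g : Fin m → ℝ) n →
  seq (∑ (λ e → f e ⊕ g e)) n ≡ seq (∑ f) n ℚ.+ seq (∑ g) n
seq-∑-+ {zero}  f g n = trans (seq-∑-zero (λ e → f e ⊕ g e) n)
  (sym (cong₂ ℚ._+_ (seq-∑-zero f n) (seq-∑-zero g n)))
seq-∑-+ {suc m} f g n = begin
  seq (∑ (λ e → f e ⊕ g e)) n
    ≡⟨ seq-∑-suc (λ e → f e ⊕ g e) n ⟩
  seq (f zero ⊕ g zero) n ℚ.+ seq (∑ (λ e → f (suc e) ⊕ g (suc e))) n
    ≡⟨ cong (ℚ._+ s₊) (seq-⊕ (f zero) (g zero) n) ⟩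
  (f₀ ℚ.+ g₀) ℚ.+ seq (∑ (λ e → f (suc e) ⊕ g (suc e))) n
    ≡⟨ cong (f₀ ℚ.+ g₀ ℚ.+_) (seq-∑-+ (λ e → f (suc e)) (λ e → g (suc e)) n) ⟩
  (f₀ ℚ.+ g₀) ℚ.+ (f₊ ℚ.+ g₊)
    ≡⟨ solve 4 (λ a b c d → (a :+ b) :+ (c :+ d) := (a :+ c) :+ (b :+ d)) refl f₀ g₀ f₊ g₊ ⟩
  (f₀ ℚ.+ f₊) ℚ.+ (g₀ ℚ.+ g₊)
    ≡⟨ cong₂ ℚ._+_ (seq-∑-suc f n) (seq-∑-suc g n) ⟨
  seq (∑ f) n ℚ.+ seq (∑ g) n ∎
  where
  open ≡-Reasoning
  open ℚ-Solver.+-*-Solver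
  s₊ = seq (∑ (λ e → f (suc e) ⊕ g (suc e))) n
  f₀ = seq (f zero) n
  g₀ = seq (g zero) n
  f₊ = seq (∑ (λ e → f (suc e))) n
  g₊ = seq (∑ (λ e → g (suc e))) n

∑-⊕-≲ : ∀ {m} (f g : Fin m → ℝ) → ∑ (λ e → f e ⊕ g e) ≲ ∑ f ⊕ ∑ g
∑-⊕-≲ f g = pointwise≡⇒≲ (λ n → trans (seq-∑-+ f g n) (sym (seq-⊕ (∑ f) (∑ g) n)))

0≲∑ : ∀ {m} {f : Fin m → ℝ} → (∀ e → 0ᵣ ≲ f e) → 0ᵣ ≲ ∑ f
0≲∑ {zero}  {f} 0≲f = pointwise≡⇒≲ (λ n → sym (seq-∑-zero f n))
0≲∑ {suc m} {f} 0≲f = ≲-trans (≲-trans (0≲f zero)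
  (x≲x⊕y (f zero) _ (0≲∑ (λ e → 0≲f (suc e))))) (∑-suc-≳ f)

∑≲0 : ∀ {m} {f : Fin m → ℝ} → (∀ e → f e ≲ 0ᵣ) → ∑ f ≲ 0ᵣ
∑≲0 {zero}  {f} f≲0 = pointwise≡⇒≲ (seq-∑-zero f)
∑≲0 {suc m} {f} f≲0 = ≲-trans (∑-suc-≲ f) (≲-trans
  (⊕-mono-≲ (f≲0 zero) (∑≲0 (λ e → f≲0 (suc e)))) (pointwise≡⇒≲ (0⊕ 0ᵣ)))

term≲∑ : ∀ {m} {f : Fin m → ℝ} → (∀ e → 0ᵣ ≲ f e) → ∀ e → f e ≲ ∑ f
term≲∑ {suc m} {f} 0≲f zero =
  ≲-trans (x≲x⊕y (f zero) _ (0≲∑ (λ e → 0≲f (suc e)))) (∑-suc-≳ f)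
term≲∑ {suc m} {f} 0≲f (suc e) = ≲-trans (term≲∑ (λ e → 0≲f (suc e)) e)
  (≲-trans (y≲x⊕y (f zero) _ (0≲f zero)) (∑-suc-≳ f))

-- Weights of edge sets

mask : Bool → ℝ → ℝ
mask b x = if b then x else 0ᵣ

weight : ∀ {m} → (Fin m → ℝ) → Subset m → ℝ
weight w Z = ∑ (λ e → mask (lookup Z e) (w e))

-- Each member of `Z` contributes `u + (1 - u) = 1`. The equality is exact at every index of the
-- sequences, so no tolerance is involved.
weight-complement : ∀ {m} (u : Fin m → ℝ) (Z : Subset m) n →
  seq (fromℤ (+ ∣ Z ∣)) n ≡ seq (weight u Z) n ℚ.+ seq (weight (λ e → complement (u e)) Z) n
weight-complement u []          n =
  sym (cong₂ ℚ._+_ (seq-∑-zero _ n) (seq-∑-zero _ n))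
weight-complement u (b ∷ Z) n = begin
  seq (fromℤ (+ ∣ b ∷ Z ∣)) n
    ≡⟨ head b ⟩
  (x₀ ℚ.+ y₀) ℚ.+ seq (fromℤ (+ ∣ Z ∣)) n
    ≡⟨ cong (x₀ ℚ.+ y₀ ℚ.+_) (weight-complement (λ e → u (suc e)) Z n) ⟩
  (x₀ ℚ.+ y₀) ℚ.+ (x₊ ℚ.+ y₊)
    ≡⟨ solve 4 (λ a b c d → (a :+ b) :+ (c :+ d) := (a :+ c) :+ (b :+ d)) refl x₀ y₀ x₊ y₊ ⟩
  (x₀ ℚ.+ x₊) ℚ.+ (y₀ ℚ.+ y₊)
    ≡⟨ cong₂ ℚ._+_ (seq-∑-suc _ n) (seq-∑-suc _ n) ⟨
  seq (weight u (b ∷ Z)) n ℚ.+ seq (weight (λ e → complement (u e)) (b ∷ Z)) n ∎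
  where
  open ≡-Reasoning
  open ℚ-Solver.+-*-Solver
  x₀ = seq (mask b (u zero)) n
  y₀ = seq (mask b (complement (u zero))) n
  x₊ = seq (weight (λ e → u (suc e)) Z) n
  y₊ = seq (weight (λ e → complement (u (suc e))) Z) n
  head : ∀ b → seq (fromℤ (+ ∣ b ∷ Z ∣)) n ≡
    (seq (mask b (u zero)) n ℚ.+ seq (mask b (complement (u zero))) n) ℚ.+ seq (fromℤ (+ ∣ Z ∣)) n
  head true  = trans (/1-homo-+ (+ 1) (+ ∣ Z ∣)) (cong (ℚ._+ (+ ∣ Z ∣) ℚ./ 1)
    (trans (solve 2 (λ o a → o := a :+ (o :- a)) refl 1ℚ (seq (u zero) n))
      (cong (seq (u zero) n ℚ.+_) (sym (seq-complement (u zero) n)))))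
  head false = sym (ℚₚ.+-identityˡ _)

lookup-─ : ∀ (p q : Subset n) i → lookup (p ─ q) i ≡ lookup p i ∧ not (lookup q i)
lookup-─ (true  ∷ p) (true  ∷ q) zero    = refl
lookup-─ (true  ∷ p) (false ∷ q) zero    = refl
lookup-─ (false ∷ p) (true  ∷ q) zero    = refl
lookup-─ (false ∷ p) (false ∷ q) zero    = refl
lookup-─ (_     ∷ p) (_     ∷ q) (suc i) = lookup-─ p q i

-- Quasi-identities between subsets hold as soon as they hold for truth values.

module SetSolver where

  infixr 7 _:∩_
  infixr 6 _:∪_
  infixl 5 _:─_
  infix  4 _:⊆_

  data Term (k : ℕ) : Set where
    var            : Fin k → Term k
    :⊥             : Term k
    _:∩_ _:∪_ _:─_ : Term k → Term k → Term k

  data Inclusion (k : ℕ) : Set where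
    _:⊆_ : Term k → Term k → Inclusion k

  ⟦_⟧ : Term k → Vec (Subset n) k → Subset n
  ⟦ var i  ⟧ ρ = lookup ρ i
  ⟦ :⊥     ⟧ ρ = ⊥
  ⟦ s :∩ t ⟧ ρ = ⟦ s ⟧ ρ ∩ ⟦ t ⟧ ρ
  ⟦ s :∪ t ⟧ ρ = ⟦ s ⟧ ρ ∪ ⟦ t ⟧ ρ
  ⟦ s :─ t ⟧ ρ = ⟦ s ⟧ ρ ─ ⟦ t ⟧ ρ

  ⟦_⟧ᵇ : Term k → Vec Bool k → Bool
  ⟦ var i  ⟧ᵇ v = lookup v i
  ⟦ :⊥     ⟧ᵇ v = false
  ⟦ s :∩ t ⟧ᵇ v = ⟦ s ⟧ᵇ v ∧ ⟦ t ⟧ᵇ v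
  ⟦ s :∪ t ⟧ᵇ v = ⟦ s ⟧ᵇ v ∨ ⟦ t ⟧ᵇ v
  ⟦ s :─ t ⟧ᵇ v = ⟦ s ⟧ᵇ v ∧ not (⟦ t ⟧ᵇ v)

  Holds : Vec (Subset n) k → Inclusion k → Set
  Holds ρ (s :⊆ t) = ⟦ s ⟧ ρ ⊆ ⟦ t ⟧ ρ

  holdsᵇ : Vec Bool k → Inclusion k → Bool
  holdsᵇ v (s :⊆ t) = not (⟦ s ⟧ᵇ v) ∨ ⟦ t ⟧ᵇ v

  entailsᵇ : List (Inclusion k) → Vec Bool k → Bool → Bool
  entailsᵇ []       v b = b
  entailsᵇ (h ∷ hs) v b = not (holdsᵇ v h) ∨ entailsᵇ hs v b

  tautology : ∀ k → (Vec Bool k → Bool) → Bool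
  tautology zero    f = f []
  tautology (suc k) f = tautology k (f ∘ (true ∷_)) ∧ tautology k (f ∘ (false ∷_))

  tautology-sound : (f : Vec Bool k → Bool) → T (tautology k f) → ∀ v → T (f v)
  tautology-sound f t []          = t
  tautology-sound f t (true  ∷ v) =
    tautology-sound (f ∘ (true ∷_)) (proj₁ (Equivalence.to T-∧ t)) v
  tautology-sound {k = suc k} f t (false ∷ v) =
    tautology-sound (f ∘ (false ∷_)) (proj₂ (Equivalence.to (T-∧ {tautology k _}) t)) v

  column : Vec (Subset n) k → Fin n → Vec Bool k
  column ρ i = map (λ S → lookup S i) ρ

  lookup-⟦⟧ : ∀ t (ρ : Vec (Subset n) k) i → lookup (⟦ t ⟧ ρ) i ≡ ⟦ t ⟧ᵇ (column ρ i)
  lookup-⟦⟧ (var j)  ρ i = sym (lookup-map j (λ S → lookup S i) ρ)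
  lookup-⟦⟧ :⊥       ρ i = lookup-replicate i false
  lookup-⟦⟧ (s :∩ t) ρ i = trans (lookup-zipWith _∧_ i (⟦ s ⟧ ρ) (⟦ t ⟧ ρ))
    (cong₂ _∧_ (lookup-⟦⟧ s ρ i) (lookup-⟦⟧ t ρ i))
  lookup-⟦⟧ (s :∪ t) ρ i = trans (lookup-zipWith _∨_ i (⟦ s ⟧ ρ) (⟦ t ⟧ ρ))
    (cong₂ _∨_ (lookup-⟦⟧ s ρ i) (lookup-⟦⟧ t ρ i))
  lookup-⟦⟧ (s :─ t) ρ i = trans (lookup-─ (⟦ s ⟧ ρ) (⟦ t ⟧ ρ) i)
    (cong₂ (λ a b → a ∧ not b) (lookup-⟦⟧ s ρ i) (lookup-⟦⟧ t ρ i))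

  implication : ∀ {a b} → (a ≡ true → b ≡ true) → T (not a ∨ b)
  implication {false} f = _
  implication {true}  f = Equivalence.from T-≡ (f refl)

  modus-ponens : ∀ {a b} → T (not a ∨ b) → T a → T b
  modus-ponens {true} ab _ = ab

  holds⇒holdsᵇ : ∀ (ρ : Vec (Subset n) k) h → Holds ρ h → ∀ i → T (holdsᵇ (column ρ i) h)
  holds⇒holdsᵇ ρ (s :⊆ t) s⊆t i = implication λ eq →
    trans (sym (lookup-⟦⟧ t ρ i))
      ([]=⇒lookup (s⊆t (lookup⇒[]= i (⟦ s ⟧ ρ) (trans (lookup-⟦⟧ s ρ i) eq))))

  discharge : ∀ (ρ : Vec (Subset n) k) {hs b} → All (Holds ρ) hs →
    ∀ i → T (entailsᵇ hs (column ρ i) b) → T b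
  discharge ρ []             i t = t
  discharge ρ (_∷_ {h} p ps) i t = discharge ρ ps i (modus-ponens t (holds⇒holdsᵇ ρ h p i))

  -- For concrete hypotheses and conclusion the implicit argument is a truth table that evaluates to
  -- the unit type, so it is filled in by computation.
  solve : (hs : List (Inclusion k)) (c : Inclusion k) →
    {_ : T (tautology k λ v → entailsᵇ hs v (holdsᵇ v c))} →
    (ρ : Vec (Subset n) k) → All (Holds ρ) hs → Holds ρ c
  solve hs c@(s :⊆ t) {taut} ρ ps {i} i∈s = lookup⇒[]= i (⟦ t ⟧ ρ)
    (trans (lookup-⟦⟧ t ρ i) (Equivalence.to T-≡ (modus-ponens
      (discharge ρ ps i (tautology-sound (λ v → entailsᵇ hs v (holdsᵇ v c)) taut (column ρ i)))
      (Equivalence.from T-≡ (trans (sym (lookup-⟦⟧ s ρ i)) ([]=⇒lookup i∈s))))))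

  solve≡ : (hs : List (Inclusion k)) (s t : Term k) →
    {_ : T (tautology k λ v → entailsᵇ hs v (holdsᵇ v (s :⊆ t)))} →
    {_ : T (tautology k λ v → entailsᵇ hs v (holdsᵇ v (t :⊆ s)))} →
    (ρ : Vec (Subset n) k) → All (Holds ρ) hs → ⟦ s ⟧ ρ ≡ ⟦ t ⟧ ρ
  solve≡ hs s t {p} {q} ρ ps = ⊆-antisym (solve hs (s :⊆ t) {p} ρ ps) (solve hs (t :⊆ s) {q} ρ ps)

  -- `a` stands for the ambient set in most uses. Environments always list three sets; when fewer
  -- occur, one is repeated as a filler.
  a x y : Term (suc (suc (suc k)))
  a = var zero
  x = var (suc zero)
  y = var (suc (suc zero))

open SetSolver

-- Weakly supermodular functions

-- The maximum becomes a disjunction and the left-hand side a free `z`, so that swapping or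
-- complementing the two sets affects the right-hand sides only.
Uncrosses : (Subset n → ℤ) → ℤ → Subset n → Subset n → Set
Uncrosses h z X Y = z ℤ.≤ h (X ∩ Y) ℤ.+ h (X ∪ Y) ⊎ z ℤ.≤ h (X ─ Y) ℤ.+ h (Y ─ X)

-- The functions live on all subsets of `Fin n` and only the property is relative to `U`; passing to
-- a part then changes no types.
WeaklySupermodularOn : Subset n → (Subset n → ℤ) → Set
WeaklySupermodularOn U h = ∀ X Y → X ⊆ U → Y ⊆ U → Uncrosses h (h X ℤ.+ h Y) X Y

SymmetricOn : Subset n → (Subset n → ℤ) → Set
SymmetricOn U h = ∀ X → X ⊆ U → h X ≡ h (U ─ X)

NormalizedOn : Subset n → (Subset n → ℤ) → Set
NormalizedOn U h = h ⊥ ≡ 0ℤ × h U ≡ 0ℤ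

-- Submodularity together with posimodularity.
StronglySubmodularOn : Subset n → (Subset n → ℤ) → Set
StronglySubmodularOn U c = ∀ X Y → X ⊆ U → Y ⊆ U →
  c (X ∩ Y) ℤ.+ c (X ∪ Y) ℤ.≤ c X ℤ.+ c Y ×
  c (X ─ Y) ℤ.+ c (Y ─ X) ℤ.≤ c X ℤ.+ c Y

module _ {U : Subset n} where

  -- Which alternative holds is decided by `h`, so `c` has to satisfy the inequality belonging to
  -- each of them.
  weaklySupermodular-minus : ∀ {h c} → WeaklySupermodularOn U h → StronglySubmodularOn U c →
    WeaklySupermodularOn U (λ S → h S ℤ.- c S)
  weaklySupermodular-minus {h} {c} wsm ssm X Y X⊆U Y⊆U =
    Sum.map (λ p → mono (X ∩ Y) (X ∪ Y) p (proj₁ (ssm X Y X⊆U Y⊆U)))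
            (λ p → mono (X ─ Y) (Y ─ X) p (proj₂ (ssm X Y X⊆U Y⊆U))) (wsm X Y X⊆U Y⊆U)
    where
    open ℤ-Solver.+-*-Solver renaming (solve to ℤ-solve)
    regroup : ∀ p q r s → (p ℤ.- r) ℤ.+ (q ℤ.- s) ≡ (p ℤ.+ q) ℤ.- (r ℤ.+ s)
    regroup = ℤ-solve 4 (λ p q r s → (p :- r) :+ (q :- s) := (p :+ q) :- (r :+ s)) refl
    mono : ∀ P Q → h X ℤ.+ h Y ℤ.≤ h P ℤ.+ h Q → c P ℤ.+ c Q ℤ.≤ c X ℤ.+ c Y →
      (h X ℤ.- c X) ℤ.+ (h Y ℤ.- c Y) ℤ.≤ (h P ℤ.- c P) ℤ.+ (h Q ℤ.- c Q)
    mono P Q h≤ c≤ =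
      subst₂ ℤ._≤_ (sym (regroup (h X) (h Y) (c X) (c Y))) (sym (regroup (h P) (h Q) (c P) (c Q)))
        (ℤₚ.+-mono-≤ h≤ (ℤₚ.neg-mono-≤ c≤))

  Uncrosses-comm : ∀ {h : Subset n → ℤ} {z} X Y → Uncrosses h z X Y → Uncrosses h z Y X
  Uncrosses-comm {h} X Y = Sum.map
    (subst₂ (λ P Q → _ ℤ.≤ h P ℤ.+ h Q)
      (solve≡ [] (x :∩ y) (y :∩ x) (U ∷ X ∷ Y ∷ []) [])
      (solve≡ [] (x :∪ y) (y :∪ x) (U ∷ X ∷ Y ∷ []) []))
    (subst (_ ℤ.≤_) (ℤₚ.+-comm (h (X ─ Y)) (h (Y ─ X))))

  -- Complementing `X` interchanges the two alternatives: `(U ─ X) ∩ Y` is `Y ─ X`, `(U ─ X) ∪ Y` is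
  -- the complement of `X ─ Y`, and similarly for the differences.
  Uncrosses-flipˡ : ∀ {h z} → SymmetricOn U h → ∀ X Y → X ⊆ U → Y ⊆ U →
    Uncrosses h z (U ─ X) Y → Uncrosses h z X Y
  Uncrosses-flipˡ {h} sym-h X Y X⊆U Y⊆U = Sum.swap ∘ Sum.map
    (subst (_ ℤ.≤_) (trans (ℤₚ.+-comm (h ((U ─ X) ∩ Y)) (h ((U ─ X) ∪ Y)))
      (cong₂ ℤ._+_
        (trans (cong h (solve≡ hyps ((a :─ x) :∪ y) (a :─ (x :─ y)) ρ ps))
               (sym (sym-h (X ─ Y) (solve hyps (x :─ y :⊆ a) ρ ps))))
        (cong h (solve≡ hyps ((a :─ x) :∩ y) (y :─ x) ρ ps)))))
    (subst (_ ℤ.≤_) (trans (ℤₚ.+-comm (h ((U ─ X) ─ Y)) (h (Y ─ (U ─ X))))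
      (cong₂ ℤ._+_
        (cong h (solve≡ hyps (y :─ (a :─ x)) (x :∩ y) ρ ps))
        (trans (cong h (solve≡ hyps ((a :─ x) :─ y) (a :─ (x :∪ y)) ρ ps))
               (sym (sym-h (X ∪ Y) (solve hyps (x :∪ y :⊆ a) ρ ps)))))))
    where
    ρ = U ∷ X ∷ Y ∷ []
    hyps : List (Inclusion 3)
    hyps = (x :⊆ a) ∷ (y :⊆ a) ∷ []
    ps : All (Holds ρ) hyps
    ps = X⊆U ∷ Y⊆U ∷ []

  Uncrosses-mono : ∀ {r h : Subset n → ℤ} {z} → (∀ S → r S ℤ.≤ h S) → ∀ X Y →
    Uncrosses r z X Y → Uncrosses h z X Y
  Uncrosses-mono r≤h X Y = Sum.map
    (λ p → ℤₚ.≤-trans p (ℤₚ.+-mono-≤ (r≤h _) (r≤h _)))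
    (λ p → ℤₚ.≤-trans p (ℤₚ.+-mono-≤ (r≤h _) (r≤h _)))

-- Symmetrisation and normalisation

symmetrise : Subset n → (Subset n → ℤ) → Subset n → ℤ
symmetrise U r X = r X ℤ.⊔ r (U ─ X)

module _ {U : Subset n} {r : Subset n → ℤ} where

  symmetrise-symmetric : SymmetricOn U (symmetrise U r)
  symmetrise-symmetric X X⊆U = trans (ℤₚ.⊔-comm (r X) (r (U ─ X)))
    (cong (λ S → r (U ─ X) ℤ.⊔ r S)
      (solve≡ ((x :⊆ a) ∷ []) x (a :─ (a :─ x)) (U ∷ X ∷ X ∷ []) (X⊆U ∷ [])))

  -- Each of the two values is attained by `r` at the set or at its complement. Uncross the sets
  -- where they are attained using `r`, pass to the larger symmetrised function, and undo the
  -- complements by its symmetry.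
  symmetrise-weaklySupermodular : WeaklySupermodularOn U r → WeaklySupermodularOn U (symmetrise U r)
  symmetrise-weaklySupermodular wsm X Y X⊆U Y⊆U =
    cases (ℤₚ.⊔-sel (r X) (r (U ─ X))) (ℤₚ.⊔-sel (r Y) (r (U ─ Y)))
    where
    s = symmetrise U r
    below : ∀ P Q → P ⊆ U → Q ⊆ U → Uncrosses s (r P ℤ.+ r Q) P Q
    below P Q P⊆U Q⊆U = Uncrosses-mono {U = U} (λ S → ℤₚ.i≤i⊔j (r S) (r (U ─ S))) P Q (wsm P Q P⊆U Q⊆U)
    U─⊆ : ∀ Z → U ─ Z ⊆ U
    U─⊆ Z = solve [] (a :─ x :⊆ a) (U ∷ Z ∷ Z ∷ []) []
    flipˡ : ∀ {z} P Q → P ⊆ U → Q ⊆ U → Uncrosses s z (U ─ P) Q → Uncrosses s z P Q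
    flipˡ = Uncrosses-flipˡ symmetrise-symmetric
    flipʳ : ∀ {z} P Q → P ⊆ U → Q ⊆ U → Uncrosses s z P (U ─ Q) → Uncrosses s z P Q
    flipʳ P Q P⊆U Q⊆U u = Uncrosses-comm {U = U} {h = s} Q P
      (flipˡ Q P Q⊆U P⊆U (Uncrosses-comm {U = U} {h = s} P (U ─ Q) u))
    cases : s X ≡ r X ⊎ s X ≡ r (U ─ X) → s Y ≡ r Y ⊎ s Y ≡ r (U ─ Y) → Uncrosses s (s X ℤ.+ s Y) X Y
    cases (inj₁ p) (inj₁ q) rewrite p | q = below X Y X⊆U Y⊆U
    cases (inj₂ p) (inj₁ q) rewrite p | q = flipˡ X Y X⊆U Y⊆U (below (U ─ X) Y (U─⊆ X) Y⊆U)
    cases (inj₁ p) (inj₂ q) rewrite p | q = flipʳ X Y X⊆U Y⊆U (below X (U ─ Y) X⊆U (U─⊆ Y))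
    cases (inj₂ p) (inj₂ q) rewrite p | q = flipˡ X Y X⊆U Y⊆U (flipʳ (U ─ X) Y (U─⊆ X) Y⊆U
      (below (U ─ X) (U ─ Y) (U─⊆ X) (U─⊆ Y)))

Trivial : Subset n → Subset n → Set
Trivial U X = X ≡ ⊥ ⊎ X ≡ U

_≟ˢ_ : (X Y : Subset n) → Dec (X ≡ Y)
_≟ˢ_ = ≡-dec Bool._≟_

trivial? : (U X : Subset n) → Dec (Trivial U X)
trivial? U X = (X ≟ˢ ⊥) ⊎-dec (X ≟ˢ U)

normalise : Subset n → (Subset n → ℤ) → Subset n → ℤ
normalise U s X with trivial? U X
... | yes _ = 0ℤ
... | no  _ = s X

normalise-trivial : ∀ {U : Subset n} {s X} → Trivial U X → normalise U s X ≡ 0ℤ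
normalise-trivial {U = U} {X = X} triv with trivial? U X
... | yes _  = refl
... | no  ¬t = contradiction triv ¬t

normalise-nontrivial : ∀ {U : Subset n} {s X} → ¬ Trivial U X → normalise U s X ≡ s X
normalise-nontrivial {U = U} {X = X} ¬triv with trivial? U X
... | yes t = contradiction t ¬triv
... | no  _ = refl

module _ {U : Subset n} {s : Subset n → ℤ} where

  normalise-normalized : NormalizedOn U (normalise U s)
  normalise-normalized = normalise-trivial {U = U} (inj₁ refl) , normalise-trivial {U = U} (inj₂ refl)

  normalise-symmetric : SymmetricOn U s → SymmetricOn U (normalise U s)
  normalise-symmetric sym-s X X⊆U with trivial? U X | trivial? U (U ─ X)
  ... | yes _           | yes _ = refl
  ... | no  _           | no  _ = sym-s X X⊆U
  ... | yes (inj₁ refl) | no ¬t = contradiction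
    (inj₂ (solve≡ [] (a :─ :⊥) a (U ∷ U ∷ U ∷ []) [])) ¬t
  ... | yes (inj₂ refl) | no ¬t = contradiction
    (inj₁ (solve≡ [] (a :─ a) :⊥ (U ∷ U ∷ U ∷ []) [])) ¬t
  ... | no ¬t | yes (inj₁ eq) = contradiction
    (inj₂ (solve≡ ((x :⊆ a) ∷ (a :─ x :⊆ :⊥) ∷ []) x a (U ∷ X ∷ X ∷ [])
      (X⊆U ∷ ⊆-reflexive eq ∷ []))) ¬t
  ... | no ¬t | yes (inj₂ eq) = contradiction
    (inj₁ (solve≡ ((x :⊆ a) ∷ (a :⊆ a :─ x) ∷ []) x :⊥ (U ∷ X ∷ X ∷ [])
      (X⊆U ∷ ⊆-reflexive (sym eq) ∷ []))) ¬t

  -- Only pairs with all four of X ∩ Y, X ─ Y, Y ─ X and U ─ (X ∪ Y) nonempty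
  -- have to be uncrossed, and for these no set involved is trivial.
  normalise-weaklySupermodular : SymmetricOn U s → WeaklySupermodularOn U s →
    WeaklySupermodularOn U (normalise U s)
  normalise-weaklySupermodular sym-s wsm X Y X⊆U Y⊆U =
    cases ((X ∩ Y) ≟ˢ ⊥) ((X ─ Y) ≟ˢ ⊥) ((Y ─ X) ≟ˢ ⊥) ((X ∪ Y) ≟ˢ U)
    where
    s′ = normalise U s
    ρ = U ∷ X ∷ Y ∷ []

    flipped : ∀ Z {Z′} → Z ⊆ U → U ─ Z ≡ Z′ → s′ Z ≡ s′ Z′
    flipped Z Z⊆U eq = trans (normalise-symmetric sym-s Z Z⊆U) (cong s′ eq)

    nontrivial : ∀ Z → Z ≢ ⊥ → Z ≢ U → s′ Z ≡ s Z
    nontrivial Z Z≢⊥ Z≢U = normalise-nontrivial Sum.[ Z≢⊥ , Z≢U ]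

    -- If one of the four sets is empty, one alternative holds with equality: its two sets are `X`
    -- and `Y` or, in the last such case, their complements.
    cases : Dec (X ∩ Y ≡ ⊥) → Dec (X ─ Y ≡ ⊥) → Dec (Y ─ X ≡ ⊥) → Dec (X ∪ Y ≡ U) →
      Uncrosses s′ (s′ X ℤ.+ s′ Y) X Y
    cases (yes eq) _ _ _ = inj₂ (ℤₚ.≤-reflexive (cong₂ (λ P Q → s′ P ℤ.+ s′ Q)
      (solve≡ ((x :∩ y :⊆ :⊥) ∷ []) x (x :─ y) ρ (⊆-reflexive eq ∷ []))
      (solve≡ ((x :∩ y :⊆ :⊥) ∷ []) y (y :─ x) ρ (⊆-reflexive eq ∷ []))))
    cases (no _) (yes eq) _ _ = inj₁ (ℤₚ.≤-reflexive (cong₂ (λ P Q → s′ P ℤ.+ s′ Q)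
      (solve≡ ((x :─ y :⊆ :⊥) ∷ []) x (x :∩ y) ρ (⊆-reflexive eq ∷ []))
      (solve≡ ((x :─ y :⊆ :⊥) ∷ []) y (x :∪ y) ρ (⊆-reflexive eq ∷ []))))
    cases (no _) (no _) (yes eq) _ = inj₁ (ℤₚ.≤-reflexive (trans (ℤₚ.+-comm (s′ X) (s′ Y))
      (cong₂ (λ P Q → s′ P ℤ.+ s′ Q)
        (solve≡ ((y :─ x :⊆ :⊥) ∷ []) y (x :∩ y) ρ (⊆-reflexive eq ∷ []))
        (solve≡ ((y :─ x :⊆ :⊥) ∷ []) x (x :∪ y) ρ (⊆-reflexive eq ∷ [])))))
    cases (no _) (no _) (no _) (yes eq) = inj₂ (ℤₚ.≤-reflexive (trans (ℤₚ.+-comm (s′ X) (s′ Y))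
      (cong₂ ℤ._+_ (flipped Y Y⊆U (solve≡ hyps (a :─ y) (x :─ y) ρ ps))
                   (flipped X X⊆U (solve≡ hyps (a :─ x) (y :─ x) ρ ps)))))
      where
      hyps : List (Inclusion 3)
      hyps = (x :⊆ a) ∷ (y :⊆ a) ∷ (a :⊆ x :∪ y) ∷ []
      ps : All (Holds ρ) hyps
      ps = X⊆U ∷ Y⊆U ∷ ⊆-reflexive (sym eq) ∷ []
    cases (no X∩Y≢⊥) (no X─Y≢⊥) (no Y─X≢⊥) (no X∪Y≢U) =
      Sum.map (subst₂ ℤ._≤_ (cong₂ ℤ._+_ X≡ Y≡) (cong₂ ℤ._+_ X∩Y≡ X∪Y≡))
              (subst₂ ℤ._≤_ (cong₂ ℤ._+_ X≡ Y≡) (cong₂ ℤ._+_ X─Y≡ Y─X≡))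
        (wsm X Y X⊆U Y⊆U)
      where
      X≡ : s X ≡ s′ X
      X≡ = sym (nontrivial X
        (λ eq → X∩Y≢⊥ (solve≡ ((x :⊆ :⊥) ∷ []) (x :∩ y) :⊥ ρ (⊆-reflexive eq ∷ [])))
        (λ eq → Y─X≢⊥ (solve≡ ((y :⊆ a) ∷ (a :⊆ x) ∷ []) (y :─ x) :⊥ ρ
                         (Y⊆U ∷ ⊆-reflexive (sym eq) ∷ []))))
      Y≡ : s Y ≡ s′ Y
      Y≡ = sym (nontrivial Y
        (λ eq → X∩Y≢⊥ (solve≡ ((y :⊆ :⊥) ∷ []) (x :∩ y) :⊥ ρ (⊆-reflexive eq ∷ [])))
        (λ eq → X─Y≢⊥ (solve≡ ((x :⊆ a) ∷ (a :⊆ y) ∷ []) (x :─ y) :⊥ ρ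
                         (X⊆U ∷ ⊆-reflexive (sym eq) ∷ []))))
      X∩Y≡ : s (X ∩ Y) ≡ s′ (X ∩ Y)
      X∩Y≡ = sym (nontrivial (X ∩ Y) X∩Y≢⊥ (λ eq → X─Y≢⊥
        (solve≡ ((x :⊆ a) ∷ (a :⊆ x :∩ y) ∷ []) (x :─ y) :⊥ ρ
          (X⊆U ∷ ⊆-reflexive (sym eq) ∷ []))))
      X∪Y≡ : s (X ∪ Y) ≡ s′ (X ∪ Y)
      X∪Y≡ = sym (nontrivial (X ∪ Y) (λ eq → X∩Y≢⊥
        (solve≡ ((x :∪ y :⊆ :⊥) ∷ []) (x :∩ y) :⊥ ρ (⊆-reflexive eq ∷ []))) X∪Y≢U)
      X─Y≡ : s (X ─ Y) ≡ s′ (X ─ Y)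
      X─Y≡ = sym (nontrivial (X ─ Y) X─Y≢⊥ (λ eq → Y─X≢⊥
        (solve≡ ((y :⊆ a) ∷ (a :⊆ x :─ y) ∷ []) (y :─ x) :⊥ ρ
          (Y⊆U ∷ ⊆-reflexive (sym eq) ∷ []))))
      Y─X≡ : s (Y ─ X) ≡ s′ (Y ─ X)
      Y─X≡ = sym (nontrivial (Y ─ X) Y─X≢⊥ (λ eq → X─Y≢⊥
        (solve≡ ((x :⊆ a) ∷ (a :⊆ y :─ x) ∷ []) (x :─ y) :⊥ ρ
          (X⊆U ∷ ⊆-reflexive (sym eq) ∷ []))))

+-cancelˡ-≤ : ∀ k {i j} → k ℤ.+ i ℤ.≤ k ℤ.+ j → i ℤ.≤ j
+-cancelˡ-≤ k {i} {j} le = subst₂ ℤ._≤_ (cancel k i) (cancel k j) (ℤₚ.+-monoʳ-≤ (ℤ.- k) le)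
  where
  cancel : ∀ k i → ℤ.- k ℤ.+ (k ℤ.+ i) ≡ i
  cancel = ℤ-solve 2 (λ k i → :- k :+ (k :+ i) := i) refl
    where open ℤ-Solver.+-*-Solver renaming (solve to ℤ-solve)

-- `M` will be the maximal excess. If only `b` contributes, then `a ≤ M` gives `s ≤ b`, and
-- symmetrically for `a`; if both contribute, `0 ≤ M` gives `s ≤ a + b`.
combine-deficits : ∀ {M a b s} → 0ℤ ℤ.≤ M → a ℤ.≤ M → b ℤ.≤ M → M ℤ.+ s ℤ.≤ a ℤ.+ b →
  (0ℤ ℤ.⊔ ℤ.- a) ℤ.+ (0ℤ ℤ.⊔ ℤ.- b) ℤ.≤ 0ℤ ℤ.⊔ ℤ.- s
combine-deficits {M} {a} {b} {s} 0≤M a≤M b≤M M+s≤a+b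
  with ℤₚ.⊔-sel 0ℤ (ℤ.- a) | ℤₚ.⊔-sel 0ℤ (ℤ.- b)
... | inj₁ p | inj₁ q rewrite p | q = ℤₚ.i≤i⊔j 0ℤ (ℤ.- s)
... | inj₁ p | inj₂ q rewrite p | q | ℤₚ.+-identityˡ (ℤ.- b) = ℤₚ.i≤j⇒i≤k⊔j 0ℤ (ℤₚ.neg-mono-≤
  (+-cancelˡ-≤ M (ℤₚ.≤-trans M+s≤a+b (ℤₚ.+-monoˡ-≤ b a≤M))))
... | inj₂ p | inj₁ q rewrite p | q | ℤₚ.+-identityʳ (ℤ.- a) = ℤₚ.i≤j⇒i≤k⊔j 0ℤ (ℤₚ.neg-mono-≤
  (+-cancelˡ-≤ M (ℤₚ.≤-trans M+s≤a+b
    (subst (a ℤ.+ b ℤ.≤_) (ℤₚ.+-comm a M) (ℤₚ.+-monoʳ-≤ a b≤M)))))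
... | inj₂ p | inj₂ q rewrite p | q | sym (ℤₚ.neg-distrib-+ a b) = ℤₚ.i≤j⇒i≤k⊔j 0ℤ (ℤₚ.neg-mono-≤
  (ℤₚ.≤-trans (subst (ℤ._≤ M ℤ.+ s) (ℤₚ.+-identityˡ s) (ℤₚ.+-monoˡ-≤ s 0≤M)) M+s≤a+b))

-- Cuts

⟨_⟩ᵇ : Bool → ℕ
⟨ true  ⟩ᵇ = 1
⟨ false ⟩ᵇ = 0

∉⇒lookup : ∀ {S : Subset m} {e} → e ∉ S → lookup S e ≡ false
∉⇒lookup {S = S} {e} e∉S with lookup S e in eq
... | true  = contradiction (lookup⇒[]= e S eq) e∉S
... | false = refl

∣∷∣ : ∀ b (P : Subset m) → ∣ b ∷ P ∣ ≡ ⟨ b ⟩ᵇ ℕ.+ ∣ P ∣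
∣∷∣ true  P = refl
∣∷∣ false P = refl

exchange : ∀ a b c d → (a ℕ.+ b) ℕ.+ (c ℕ.+ d) ≡ (a ℕ.+ c) ℕ.+ (b ℕ.+ d)
exchange = ℕ-solve 4 (λ a b c d → (a :+ b) :+ (c :+ d) := (a :+ c) :+ (b :+ d)) refl
  where open ℕ-Solver.+-*-Solver renaming (solve to ℕ-solve)

∣∣-+-≤ : (P Q R S : Subset m) →
  (∀ e → ⟨ lookup P e ⟩ᵇ ℕ.+ ⟨ lookup Q e ⟩ᵇ ℕ.≤ ⟨ lookup R e ⟩ᵇ ℕ.+ ⟨ lookup S e ⟩ᵇ) →
  ∣ P ∣ ℕ.+ ∣ Q ∣ ℕ.≤ ∣ R ∣ ℕ.+ ∣ S ∣
∣∣-+-≤ []      []      []      []      _ = ℕ.z≤n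
∣∣-+-≤ (p ∷ P) (q ∷ Q) (r ∷ R) (s ∷ S) le
  rewrite ∣∷∣ p P | ∣∷∣ q Q | ∣∷∣ r R | ∣∷∣ s S = subst₂ ℕ._≤_
    (exchange ⟨ p ⟩ᵇ ⟨ q ⟩ᵇ ∣ P ∣ ∣ Q ∣) (exchange ⟨ r ⟩ᵇ ⟨ s ⟩ᵇ ∣ R ∣ ∣ S ∣)
    (ℕₚ.+-mono-≤ (le zero) (∣∣-+-≤ P Q R S (λ e → le (suc e))))

∣∣-+-≡ : (P Q R : Subset m) →
  (∀ e → ⟨ lookup P e ⟩ᵇ ≡ ⟨ lookup Q e ⟩ᵇ ℕ.+ ⟨ lookup R e ⟩ᵇ) →
  ∣ P ∣ ≡ ∣ Q ∣ ℕ.+ ∣ R ∣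
∣∣-+-≡ []      []      []      _ = refl
∣∣-+-≡ (p ∷ P) (q ∷ Q) (r ∷ R) eq
  rewrite ∣∷∣ p P | ∣∷∣ q Q | ∣∷∣ r R =
    trans (cong₂ ℕ._+_ (eq zero) (∣∣-+-≡ P Q R (λ e → eq (suc e))))
      (exchange ⟨ q ⟩ᵇ ⟨ r ⟩ᵇ ∣ Q ∣ ∣ R ∣)

-- Statements about edge sets built from crossing and inner are decided by the
-- truth values at the two ends of an edge.

module EdgeSolver (Eg : Subset m) (ends : Fin m → Fin n × Fin n) where

  infixr 7 _:∧_

  data EdgeTerm (k : ℕ) : Set where
    :E             : EdgeTerm k
    :inner :cross  : Term k → EdgeTerm k
    _:∧_           : EdgeTerm k → EdgeTerm k → EdgeTerm k

  ⟦_⟧ᴱ : EdgeTerm k → Vec (Subset n) k → Subset m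
  ⟦ :E       ⟧ᴱ ρ = Eg
  ⟦ :inner t ⟧ᴱ ρ = inner ends (⟦ t ⟧ ρ)
  ⟦ :cross t ⟧ᴱ ρ = crossing ends (⟦ t ⟧ ρ)
  ⟦ s :∧ t   ⟧ᴱ ρ = ⟦ s ⟧ᴱ ρ ∩ ⟦ t ⟧ᴱ ρ

  ⟦_⟧ᴱᵇ : EdgeTerm k → Bool → Vec Bool k → Vec Bool k → Bool
  ⟦ :E       ⟧ᴱᵇ b v v′ = b
  ⟦ :inner t ⟧ᴱᵇ b v v′ = ⟦ t ⟧ᵇ v ∧ ⟦ t ⟧ᵇ v′
  ⟦ :cross t ⟧ᴱᵇ b v v′ = ⟦ t ⟧ᵇ v xor ⟦ t ⟧ᵇ v′
  ⟦ s :∧ t   ⟧ᴱᵇ b v v′ = ⟦ s ⟧ᴱᵇ b v v′ ∧ ⟦ t ⟧ᴱᵇ b v v′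

  lookup-⟦⟧ᴱ : ∀ (ρ : Vec (Subset n) k) e t → lookup (⟦ t ⟧ᴱ ρ) e ≡
    ⟦ t ⟧ᴱᵇ (lookup Eg e) (column ρ (proj₁ (ends e))) (column ρ (proj₂ (ends e)))
  lookup-⟦⟧ᴱ ρ e :E         = refl
  lookup-⟦⟧ᴱ ρ e (:inner t) = trans (lookup∘tabulate _ e)
    (cong₂ _∧_ (lookup-⟦⟧ t ρ (proj₁ (ends e))) (lookup-⟦⟧ t ρ (proj₂ (ends e))))
  lookup-⟦⟧ᴱ ρ e (:cross t) = trans (lookup∘tabulate _ e)
    (cong₂ _xor_ (lookup-⟦⟧ t ρ (proj₁ (ends e))) (lookup-⟦⟧ t ρ (proj₂ (ends e))))
  lookup-⟦⟧ᴱ ρ e (s :∧ t)   = trans (lookup-zipWith _∧_ e (⟦ s ⟧ᴱ ρ) (⟦ t ⟧ᴱ ρ))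
    (cong₂ _∧_ (lookup-⟦⟧ᴱ ρ e s) (lookup-⟦⟧ᴱ ρ e t))

  entailsᴱᵇ : List (Inclusion k) → (Bool → Vec Bool k → Vec Bool k → Bool) →
    Bool → Vec Bool k → Vec Bool k → Bool
  entailsᴱᵇ hs F b v v′ = entailsᵇ hs v (entailsᵇ hs v′ (F b v v′))

  validᴱ : List (Inclusion k) → (Bool → Vec Bool k → Vec Bool k → Bool) → Bool
  validᴱ {k} hs F = tautology k λ v → tautology k λ v′ →
    entailsᴱᵇ hs F true v v′ ∧ entailsᴱᵇ hs F false v v′

  validᴱ-sound : (hs : List (Inclusion k)) (F : Bool → Vec Bool k → Vec Bool k → Bool) →
    T (validᴱ hs F) → ∀ b v v′ → T (entailsᴱᵇ hs F b v v′)
  validᴱ-sound {k} hs F valid b v v′ = choose b (tautology-sound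
    (λ v′ → entailsᴱᵇ hs F true v v′ ∧ entailsᴱᵇ hs F false v v′)
    (tautology-sound
      (λ v → tautology k λ v′ → entailsᴱᵇ hs F true v v′ ∧ entailsᴱᵇ hs F false v v′) valid v) v′)
    where
    choose : ∀ b → T (entailsᴱᵇ hs F true v v′ ∧ entailsᴱᵇ hs F false v v′) → T (entailsᴱᵇ hs F b v v′)
    choose true  t = proj₁ (Equivalence.to T-∧ t)
    choose false t = proj₂ (Equivalence.to (T-∧ {entailsᴱᵇ hs F true v v′}) t)

  -- `P` is an arbitrary Boolean test, so besides inclusions this also checks the contribution of a
  -- single edge to identities and inequalities between cardinalities.
  solveᴱ : (hs : List (Inclusion k)) (ts : Vec (EdgeTerm k) j) (P : Vec Bool j → Bool) →
    {_ : T (validᴱ hs λ b v v′ → P (map (λ t → ⟦ t ⟧ᴱᵇ b v v′) ts))} →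
    (ρ : Vec (Subset n) k) → All (Holds ρ) hs →
    ∀ e → T (P (map (λ t → lookup (⟦ t ⟧ᴱ ρ) e) ts))
  solveᴱ hs ts P {valid} ρ ps e = subst (λ bs → T (P bs))
    (sym (map-cong (lookup-⟦⟧ᴱ ρ e) ts))
    (discharge ρ ps (proj₂ (ends e)) (discharge ρ ps (proj₁ (ends e))
      (validᴱ-sound hs (λ b v v′ → P (map (λ t → ⟦ t ⟧ᴱᵇ b v v′) ts)) valid
        (lookup Eg e) (column ρ (proj₁ (ends e))) (column ρ (proj₂ (ends e))))))

  infix 4 _⟹_
  _⟹_ : Bool → Bool → Bool
  p ⟹ q = not p ∨ q

  solveᴱ⊆ : (hs : List (Inclusion k)) (s t : EdgeTerm k) →
    {_ : T (validᴱ hs λ b v v′ → ⟦ s ⟧ᴱᵇ b v v′ ⟹ ⟦ t ⟧ᴱᵇ b v v′)} →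
    (ρ : Vec (Subset n) k) → All (Holds ρ) hs → ⟦ s ⟧ᴱ ρ ⊆ ⟦ t ⟧ᴱ ρ
  solveᴱ⊆ hs s t {taut} ρ ps {e} e∈s = lookup⇒[]= e _ (Equivalence.to T-≡ (modus-ponens
    (solveᴱ hs (s ∷ t ∷ []) (λ { (p ∷ q ∷ []) → p ⟹ q }) {taut} ρ ps e)
    (Equivalence.from T-≡ ([]=⇒lookup e∈s))))

∈-crossing⁻ : ∀ (ends : Fin m → Fin n × Fin n) S {e} → e ∈ crossing ends S →
  (proj₁ (ends e) ∈ S × proj₂ (ends e) ∉ S) ⊎ (proj₁ (ends e) ∉ S × proj₂ (ends e) ∈ S)
∈-crossing⁻ ends S {e} e∈ with proj₁ (ends e) ∈? S | proj₂ (ends e) ∈? S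
... | yes p | no  q = inj₁ (p , q)
... | no  p | yes q = inj₂ (p , q)
... | yes p | yes q = contradiction
  (trans (sym (trans (lookup∘tabulate _ e) (cong₂ _xor_ ([]=⇒lookup p) ([]=⇒lookup q)))) ([]=⇒lookup e∈))
  λ ()
... | no  p | no  q = contradiction
  (trans (sym (trans (lookup∘tabulate _ e) (cong₂ _xor_ (∉⇒lookup p) (∉⇒lookup q)))) ([]=⇒lookup e∈))
  λ ()

∈-crossing⁺ : ∀ (ends : Fin m → Fin n × Fin n) S {e} →
  (proj₁ (ends e) ∈ S × proj₂ (ends e) ∉ S) ⊎ (proj₁ (ends e) ∉ S × proj₂ (ends e) ∈ S) →
  e ∈ crossing ends S
∈-crossing⁺ ends S {e} (inj₁ (p , q)) = lookup⇒[]= e _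
  (trans (lookup∘tabulate _ e) (cong₂ _xor_ ([]=⇒lookup p) (∉⇒lookup q)))
∈-crossing⁺ ends S {e} (inj₂ (p , q)) = lookup⇒[]= e _
  (trans (lookup∘tabulate _ e) (cong₂ _xor_ (∉⇒lookup p) ([]=⇒lookup q)))

∈-inner⁺ : ∀ (ends : Fin m → Fin n × Fin n) S {e} →
  proj₁ (ends e) ∈ S → proj₂ (ends e) ∈ S → e ∈ inner ends S
∈-inner⁺ ends S {e} p q = lookup⇒[]= e _
  (trans (lookup∘tabulate _ e) (cong₂ _∧_ ([]=⇒lookup p) ([]=⇒lookup q)))

module Cuts (Eg : Subset m) (ends : Fin m → Fin n × Fin n) where

  open EdgeSolver Eg ends

  -- The edges leaving S in the subgraph induced by U.
  ∂ : Subset n → Subset n → Subset m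
  ∂ U S = (Eg ∩ inner ends U) ∩ crossing ends S

  :∂ : Term k → Term k → EdgeTerm k
  :∂ u s = (:E :∧ :inner u) :∧ :cross s

  ∂-complement : ∀ U S → ∂ U S ≡ ∂ U (U ─ S)
  ∂-complement U S = ⊆-antisym
    (solveᴱ⊆ [] (:∂ a x) (:∂ a (a :─ x)) (U ∷ S ∷ S ∷ []) [])
    (solveᴱ⊆ [] (:∂ a (a :─ x)) (:∂ a x) (U ∷ S ∷ S ∷ []) [])

  -- Here U, A and X are listed as a, x and y.
  ∣∂∣-restrict : ∀ {U A X} → A ⊆ U → X ⊆ A →
    ∣ ∂ U X ∣ ≡ ∣ ∂ A X ∣ ℕ.+ ∣ ∂ U A ∩ crossing ends X ∣
  ∣∂∣-restrict {U} {A} {X} A⊆U X⊆A = ∣∣-+-≡ (∂ U X) (∂ A X) (∂ U A ∩ crossing ends X) λ e →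
    ℕₚ.≡ᵇ⇒≡ _ _ (solveᴱ ((x :⊆ a) ∷ (y :⊆ x) ∷ []) (:∂ a y ∷ :∂ x y ∷ (:∂ a x :∧ :cross y) ∷ [])
      (λ { (p ∷ q ∷ r ∷ []) → ⟨ p ⟩ᵇ ℕ.≡ᵇ ⟨ q ⟩ᵇ ℕ.+ ⟨ r ⟩ᵇ }) (U ∷ A ∷ X ∷ []) (A⊆U ∷ X⊆A ∷ []) e)

  module _ {w : Fin m → ℝ} where

    term : Subset m → Fin m → ℝ
    term Z e = mask (lookup Z e) (w e)

    mask≳0 : ∀ b {z} → 0ᵣ ≲ z → 0ᵣ ≲ mask b z
    mask≳0 true  0≲z = 0≲z
    mask≳0 false _   = ≲-refl

    weight-⊆ : (∀ e → 0ᵣ ≲ w e) → ∀ {Y Z} → Y ⊆ Z → weight w Y ≲ weight w Z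
    weight-⊆ 0≲w {Y} {Z} Y⊆Z = ∑-mono λ e → mask-mono e (lookup Y e) (lookup Z e) refl refl
      where
      mask-mono : ∀ e p q → lookup Y e ≡ p → lookup Z e ≡ q → mask p (w e) ≲ mask q (w e)
      mask-mono e true  true  _  _  = ≲-refl
      mask-mono e false true  _  _  = 0≲w e
      mask-mono e false false _  _  = ≲-refl
      mask-mono e true  false eq eq′ =
        contradiction (trans (sym ([]=⇒lookup (Y⊆Z (lookup⇒[]= e Y eq)))) eq′) λ ()

    weight≲0 : ∀ {Z} → (∀ e → e ∈ Z → w e ≲ 0ᵣ) → weight w Z ≲ 0ᵣ
    weight≲0 {Z} w≲0 = ∑≲0 λ e → mask≲0 e (lookup Z e) refl
      where
      mask≲0 : ∀ e p → lookup Z e ≡ p → mask p (w e) ≲ 0ᵣ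
      mask≲0 e true  eq = w≲0 e (lookup⇒[]= e Z eq)
      mask≲0 e false eq = ≲-refl

    weight≲0⇒ : (∀ e → 0ᵣ ≲ w e) → ∀ {Z} → weight w Z ≲ 0ᵣ → ∀ e → e ∈ Z → w e ≲ 0ᵣ
    weight≲0⇒ 0≲w {Z} Z≲0 e e∈Z = ≲-trans
      (subst (λ b → w e ≲ mask b (w e)) (sym ([]=⇒lookup e∈Z)) ≲-refl)
      (≲-trans (term≲∑ (λ e → mask≳0 (lookup Z e) (0≲w e)) e) Z≲0)

    -- An edge leaving `S` inside `U` either leaves `A`, where its weight vanishes, or has both ends
    -- in `A` or both in `U ─ A`, where it is counted on the right.
    weight-split : (∀ e → 0ᵣ ≲ w e) → ∀ {U A} → (∀ e → e ∈ ∂ U A → w e ≲ 0ᵣ) → ∀ S →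
      weight w (∂ U S) ≲ weight w (∂ A (A ∩ S)) ⊕ weight w (∂ (U ─ A) ((U ─ A) ∩ S))
    weight-split 0≲w {U} {A} tight S = ≲-trans
      (∑-mono λ e →
        mask-split e (lookup (∂ U S) e) (lookup (∂ U A) e)
          (lookup (∂ A (A ∩ S)) e) (lookup (∂ (U ─ A) ((U ─ A) ∩ S)) e)
          (λ eq → tight e (lookup⇒[]= e _ eq))
          (solveᴱ [] (:∂ a y ∷ :∂ a x ∷ :∂ x (x :∩ y) ∷ :∂ (a :─ x) ((a :─ x) :∩ y) ∷ [])
            (λ { (p ∷ q ∷ r ∷ s ∷ []) → p ⟹ (q ∨ r ∨ s) }) (U ∷ A ∷ S ∷ []) [] e))
      (∑-⊕-≲ (term (∂ A (A ∩ S))) (term (∂ (U ─ A) ((U ─ A) ∩ S))))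
      where
      mask≲ : ∀ e p r → T (p ⟹ r) → mask p (w e) ≲ mask r (w e)
      mask≲ e true  true  _ = ≲-refl
      mask≲ e false r     _ = mask≳0 r (0≲w e)
      ⟹-true : ∀ p → T (p ⟹ true)
      ⟹-true true  = _
      ⟹-true false = _
      mask-split : ∀ e p q r s → (q ≡ true → w e ≲ 0ᵣ) → T (p ⟹ (q ∨ r ∨ s)) →
        mask p (w e) ≲ mask r (w e) ⊕ mask s (w e)
      mask-split e p q true  s     h _ =
        ≲-trans (mask≲ e p true (⟹-true p)) (x≲x⊕y _ _ (mask≳0 s (0≲w e)))
      mask-split e p q false true  h _ =
        ≲-trans (mask≲ e p true (⟹-true p)) (y≲x⊕y _ _ ≲-refl)
      mask-split e p true false false h _ =
        ≲-trans (mask≲ e p true (⟹-true p)) (≲-trans (h refl) (x≲x⊕y _ _ ≲-refl))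
      mask-split e false false false false h _ = x≲x⊕y _ _ ≲-refl

-- Both inequalities hold edge by edge. Since `D` is any edge set, this covers the degree function
-- of an induced subgraph as well as the discount, which counts only edges of `∂ U A`.
cut-stronglySubmodular : ∀ (D : Subset m) (ends : Fin m → Fin n × Fin n) U →
  StronglySubmodularOn U (λ S → + ∣ D ∩ crossing ends S ∣)
cut-stronglySubmodular {m} D ends U X Y _ _ =
    ℤ.+≤+ (∣∣-+-≤ (∂D (X ∩ Y)) (∂D (X ∪ Y)) (∂D X) (∂D Y) λ e → ℕₚ.≤ᵇ⇒≤ _ _
      (solveᴱ [] (:∂D (x :∩ y) ∷ :∂D (x :∪ y) ∷ :∂D x ∷ :∂D y ∷ []) crossings (U ∷ X ∷ Y ∷ []) [] e))
  , ℤ.+≤+ (∣∣-+-≤ (∂D (X ─ Y)) (∂D (Y ─ X)) (∂D X) (∂D Y) λ e → ℕₚ.≤ᵇ⇒≤ _ _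
      (solveᴱ [] (:∂D (x :─ y) ∷ :∂D (y :─ x) ∷ :∂D x ∷ :∂D y ∷ []) crossings (U ∷ X ∷ Y ∷ []) [] e))
  where
  open EdgeSolver D ends
  ∂D : Subset _ → Subset m
  ∂D S = D ∩ crossing ends S
  :∂D : Term k → EdgeTerm k
  :∂D s = :E :∧ :cross s
  crossings : Vec Bool 4 → Bool
  crossings (p ∷ q ∷ r ∷ s ∷ []) = ⟨ p ⟩ᵇ ℕ.+ ⟨ q ⟩ᵇ ℕ.≤ᵇ ⟨ r ⟩ᵇ ℕ.+ ⟨ s ⟩ᵇ

-- Decomposition along a set of maximal excess

maximiser : (g : Subset n → ℤ) → ∃[ A ] ∀ S → g S ℤ.≤ g A
maximiser {zero}  g = [] , λ { [] → ℤₚ.≤-refl }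
maximiser {suc n} g with maximiser (g ∘ (true ∷_)) | maximiser (g ∘ (false ∷_))
... | A , A-max | B , B-max with ℤₚ.≤-total (g (true ∷ A)) (g (false ∷ B))
...   | inj₁ A≤B = false ∷ B , λ { (true ∷ S) → ℤₚ.≤-trans (A-max S) A≤B ; (false ∷ S) → B-max S }
...   | inj₂ B≤A = true  ∷ A , λ { (true ∷ S) → A-max S ; (false ∷ S) → ℤₚ.≤-trans (B-max S) B≤A }

module Decompositions (Eg : Subset m) (ends : Fin m → Fin n × Fin n) where

  open EdgeSolver Eg ends
  open Cuts Eg ends

  excess : Subset n → (Subset n → ℤ) → Subset n → ℤ
  excess U h S = h S ℤ.- + ∣ ∂ U S ∣

  CutRelaxed : Subset n → (Subset n → ℤ) → (Fin m → ℝ) → Set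
  CutRelaxed U h w = ∀ S → S ⊆ U → weight w (∂ U S) ≲ fromℤ (0ℤ ℤ.⊔ ℤ.- excess U h S)

  -- The cut constraints of (NDP) for `x = 1 - w`; they differ from `CutRelaxed` by the missing
  -- truncation at 0.
  Bounded : Subset n → (Subset n → ℤ) → (Fin m → ℝ) → Set
  Bounded U h w = ∀ S → S ⊆ U → weight w (∂ U S) ≲ fromℤ (ℤ.- excess U h S)

  -- Together with `w ≥ 0` this says that `w` vanishes, hence `x = 1`, on the cut.
  Tight : Subset n → Subset n → (Fin m → ℝ) → Set
  Tight U S w = ∀ e → e ∈ ∂ U S → w e ≲ 0ᵣ

  record Admissible (U : Subset n) (h : Subset n → ℤ) : Set where
    field
      weaklySupermodular : WeaklySupermodularOn U h
      symmetric          : SymmetricOn U h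
      normalized         : NormalizedOn U h
  open Admissible

  -- With x = 1 - w this is the theorem for the subgraph induced by U.
  record Decomposition (U : Subset n) (h : Subset n → ℤ) : Set₁ where
    field
      {size}       : ℕ
      Index        : Set
      enumeration  : Fin size ↔ Index
      part         : Index → Subset n
      bound        : Index → Subset n → ℤ
      part⊆        : ∀ i → part i ⊆ U
      nonempty     : ∀ i → Nonempty (part i)
      disjoint     : ∀ i j → i ≢ j → Empty (part i ∩ part j)
      covers       : ∀ v → v ∈ U → ∃[ i ] v ∈ part i
      admissible   : ∀ i → Admissible (part i) (bound i)
      split        : ∀ {w} → (∀ e → 0ᵣ ≲ w e) → CutRelaxed U h w →
                     ∀ i → Tight U (part i) w × Bounded (part i) (bound i) w
      unsplit      : ∀ {w} → (∀ e → 0ᵣ ≲ w e) →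
                     (∀ i → Tight U (part i) w × Bounded (part i) (bound i) w) → CutRelaxed U h w

  ∂-trivial : ∀ {U S} → Trivial U S → ∀ {e} → e ∉ ∂ U S
  ∂-trivial {U} (inj₁ refl) {e} e∈ = subst (T ∘ not) ([]=⇒lookup e∈)
    (solveᴱ [] (:∂ a :⊥ ∷ []) (λ { (p ∷ []) → not p }) (U ∷ U ∷ U ∷ []) [] e)
  ∂-trivial {U} (inj₂ refl) {e} e∈ = subst (T ∘ not) ([]=⇒lookup e∈)
    (solveᴱ [] (:∂ a a ∷ []) (λ { (p ∷ []) → not p }) (U ∷ U ∷ U ∷ []) [] e)

  weight-trivial : ∀ {U S} → Trivial U S → ∀ {w} → weight w (∂ U S) ≲ 0ᵣ
  weight-trivial triv = weight≲0 λ e e∈ → contradiction e∈ (∂-trivial triv)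

  ∂-mono : ∀ {A U} → A ⊆ U → ∀ S → ∂ A S ⊆ ∂ U S
  ∂-mono {A} {U} A⊆U S = solveᴱ⊆ ((x :⊆ a) ∷ []) (:∂ x y) (:∂ a y) (U ∷ A ∷ S ∷ []) (A⊆U ∷ [])

  -- An edge leaving `P` inside `U` either leaves `A` or leaves `P` inside `A`.
  tight-extend : ∀ {w P A U} → P ⊆ A → A ⊆ U → Tight U A w → Tight A P w → Tight U P w
  tight-extend {w} {P} {A} {U} P⊆A A⊆U tightA tightP e e∈ with e ∈? ∂ U A | e ∈? ∂ A P
  ... | yes p | _     = tightA e p
  ... | no _  | yes q = tightP e q
  ... | no p  | no q  = contradiction
    (solveᴱ ((x :⊆ a) ∷ (y :⊆ x) ∷ []) (:∂ a y ∷ :∂ a x ∷ :∂ x y ∷ [])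
      (λ { (r ∷ p ∷ q ∷ []) → r ⟹ (p ∨ q) }) (U ∷ A ∷ P ∷ []) (A⊆U ∷ P⊆A ∷ []) e)
    (λ t → subst T (cong₂ _⟹_ ([]=⇒lookup e∈) (cong₂ _∨_ (∉⇒lookup p) (∉⇒lookup q))) t)

  0≤0⊔ : ∀ z → 0ᵣ ≲ fromℤ (0ℤ ℤ.⊔ z)
  0≤0⊔ z = fromℤ-mono (ℤₚ.i≤i⊔j 0ℤ z)

  -- Parts must be nonempty, so the empty set gets none. The relaxed constraints then hold outright,
  -- since the only cut is empty.
  decomposition-empty : ∀ {U h} → Empty U → Decomposition U h
  decomposition-empty {U} {h} U-empty = record
    { Index       = Fin 0
    ; enumeration = ↔-id (Fin 0)
    ; part        = λ ()
    ; bound       = λ ()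
    ; part⊆       = λ ()
    ; nonempty    = λ ()
    ; disjoint    = λ ()
    ; covers      = λ v v∈U → contradiction (v , v∈U) U-empty
    ; admissible  = λ ()
    ; split       = λ _ _ ()
    ; unsplit     = λ _ _ S S⊆U → ≲-trans
        (weight-trivial {U} (inj₁ (Empty-unique λ (v , v∈S) → U-empty (v , S⊆U v∈S))))
        (0≤0⊔ (ℤ.- excess U h S))
    }

  decomposition-whole : ∀ {U h} → Nonempty U → Admissible U h →
    (∀ S → S ⊆ U → excess U h S ℤ.≤ 0ℤ) → Decomposition U h
  decomposition-whole {U} {h} ne adm excess≤0 = record
    { Index       = Fin 1
    ; enumeration = ↔-id (Fin 1)
    ; part        = λ _ → U
    ; bound       = λ _ → h
    ; part⊆       = λ _ → ⊆-refl
    ; nonempty    = λ _ → ne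
    ; disjoint    = λ { zero zero 0≢0 → contradiction refl 0≢0 }
    ; covers      = λ v v∈U → zero , v∈U
    ; admissible  = λ _ → adm
    ; split       = λ 0≲w cr _ →
          weight≲0⇒ 0≲w (weight-trivial {U} (inj₂ refl))
        , λ S S⊆U → subst (λ z → _ ≲ fromℤ z) (0⊔-excess S S⊆U) (cr S S⊆U)
    ; unsplit     = λ 0≲w parts S S⊆U →
        subst (λ z → _ ≲ fromℤ z) (sym (0⊔-excess S S⊆U)) (proj₂ (parts zero) S S⊆U)
    }
    where
    0⊔-excess : ∀ S → S ⊆ U → 0ℤ ℤ.⊔ ℤ.- excess U h S ≡ ℤ.- excess U h S
    0⊔-excess S S⊆U = ℤₚ.i≤j⇒i⊔j≡j (ℤₚ.neg-mono-≤ (excess≤0 S S⊆U))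

  module Restriction (U : Subset n) (h : Subset n → ℤ) (A : Subset n) (A⊆U : A ⊆ U) where

    -- The edges of U between X and U ─ A are among the edges forced by A.
    discounted : Subset n → ℤ
    discounted X = h X ℤ.- + ∣ ∂ U A ∩ crossing ends X ∣

    restricted : Subset n → ℤ
    restricted = normalise A (symmetrise A discounted)

    restricted-admissible : Admissible U h → Admissible A restricted
    restricted-admissible adm = record
      { weaklySupermodular = normalise-weaklySupermodular
          {U = A} {s = symmetrise A discounted} symmetrise-symmetric
          (symmetrise-weaklySupermodular {r = discounted} (weaklySupermodular-minus
            {h = h} {c = λ X → + ∣ ∂ U A ∩ crossing ends X ∣}
            (λ X Y X⊆A Y⊆A → weaklySupermodular adm X Y (⊆-trans X⊆A A⊆U) (⊆-trans Y⊆A A⊆U))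
            (cut-stronglySubmodular (∂ U A) ends A)))
      ; symmetric  = normalise-symmetric {U = A} {s = symmetrise A discounted} symmetrise-symmetric
      ; normalized = normalise-normalized {U = A} {s = symmetrise A discounted}
      }

    -- For `X` and for `A ─ X`, the discounted edges and the cut inside `A` together make up the cut
    -- inside `U`. The cut inside `A` is the same for both sets, so it can be subtracted inside the
    -- maximum.
    excess-restricted : ∀ {X} → X ⊆ A → ¬ Trivial A X →
      excess A restricted X ≡ excess U h X ℤ.⊔ excess U h (A ─ X)
    excess-restricted {X} X⊆A ¬triv = begin
      restricted X ℤ.- + ∣ ∂ A X ∣
        ≡⟨ cong (ℤ._- + ∣ ∂ A X ∣) (normalise-nontrivial ¬triv) ⟩
      (discounted X ℤ.⊔ discounted (A ─ X)) ℤ.- + ∣ ∂ A X ∣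
        ≡⟨ ℤₚ.mono-≤-distrib-⊔ (ℤₚ.+-monoˡ-≤ (ℤ.- + ∣ ∂ A X ∣)) (discounted X) (discounted (A ─ X)) ⟩
      (discounted X ℤ.- + ∣ ∂ A X ∣) ℤ.⊔ (discounted (A ─ X) ℤ.- + ∣ ∂ A X ∣)
        ≡⟨ cong (λ Z → (discounted X ℤ.- + ∣ ∂ A X ∣) ℤ.⊔ (discounted (A ─ X) ℤ.- + ∣ Z ∣))
             (∂-complement A X) ⟩
      (discounted X ℤ.- + ∣ ∂ A X ∣) ℤ.⊔ (discounted (A ─ X) ℤ.- + ∣ ∂ A (A ─ X) ∣)
        ≡⟨ cong₂ ℤ._⊔_ (undiscount X X⊆A) (undiscount (A ─ X) (p─q⊆p A X)) ⟩
      excess U h X ℤ.⊔ excess U h (A ─ X) ∎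
      where
      open ≡-Reasoning
      open ℤ-Solver.+-*-Solver renaming (solve to ℤ-solve)
      undiscount : ∀ Y → Y ⊆ A → discounted Y ℤ.- + ∣ ∂ A Y ∣ ≡ excess U h Y
      undiscount Y Y⊆A = trans
        (ℤ-solve 3 (λ h c d → h :- c :- d := h :- (d :+ c)) refl
          (h Y) (+ ∣ ∂ U A ∩ crossing ends Y ∣) (+ ∣ ∂ A Y ∣))
        (cong (λ z → h Y ℤ.- z) (sym (trans (cong +_ (∣∂∣-restrict A⊆U Y⊆A))
          (ℤₚ.pos-+ ∣ ∂ A Y ∣ ∣ ∂ U A ∩ crossing ends Y ∣))))

    module _ {w : Fin m → ℝ} where

      -- The new bound at `X` is the old one at `X` or at `A ─ X`, and `∂ A X` is contained in both
      -- of the corresponding cuts of `U`.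
      restrict-cutRelaxed : (∀ e → 0ᵣ ≲ w e) → CutRelaxed U h w → CutRelaxed A restricted w
      restrict-cutRelaxed 0≲w cr X X⊆A = cases (trivial? A X)
        where
        bound : ∀ {z} → z ≡ excess U h X ⊎ z ≡ excess U h (A ─ X) →
          weight w (∂ A X) ≲ fromℤ (0ℤ ℤ.⊔ ℤ.- z)
        bound (inj₁ refl) = ≲-trans (weight-⊆ 0≲w (∂-mono A⊆U X)) (cr X (⊆-trans X⊆A A⊆U))
        bound (inj₂ refl) = subst (λ Z → weight w Z ≲ fromℤ (0ℤ ℤ.⊔ ℤ.- excess U h (A ─ X)))
          (sym (∂-complement A X))
          (≲-trans (weight-⊆ 0≲w (∂-mono A⊆U (A ─ X))) (cr (A ─ X) (⊆-trans (p─q⊆p A X) A⊆U)))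
        cases : Dec (Trivial A X) → weight w (∂ A X) ≲ fromℤ (0ℤ ℤ.⊔ ℤ.- excess A restricted X)
        cases (yes triv) = ≲-trans (weight-trivial triv) (0≤0⊔ (ℤ.- excess A restricted X))
        cases (no ¬triv) = subst (λ z → weight w (∂ A X) ≲ fromℤ (0ℤ ℤ.⊔ ℤ.- z))
          (sym (excess-restricted X⊆A ¬triv))
          (bound (ℤₚ.⊔-sel (excess U h X) (excess U h (A ─ X))))

      -- The form used for gluing: it suffices to compare with one of the two excesses. At the
      -- trivial sets, where the requirement was reset, the empty cut satisfies any truncated bound.
      cutRelaxed-below : CutRelaxed A restricted w → ∀ {X g} → X ⊆ A →
        g ℤ.≤ excess U h X ℤ.⊔ excess U h (A ─ X) →
        weight w (∂ A X) ≲ fromℤ (0ℤ ℤ.⊔ ℤ.- g)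
      cutRelaxed-below cr {X} {g} X⊆A g≤ = cases (trivial? A X)
        where
        cases : Dec (Trivial A X) → weight w (∂ A X) ≲ fromℤ (0ℤ ℤ.⊔ ℤ.- g)
        cases (yes triv) = ≲-trans (weight-trivial triv) (0≤0⊔ (ℤ.- g))
        cases (no ¬triv) = ≲-trans (cr X X⊆A) (fromℤ-mono (ℤₚ.⊔-monoʳ-≤ 0ℤ (ℤₚ.neg-mono-≤
          (subst (g ℤ.≤_) (sym (excess-restricted X⊆A ¬triv)) g≤))))

  module Split {U : Subset n} {h : Subset n → ℤ} (adm : Admissible U h) {A : Subset n} (A⊆U : A ⊆ U)
    (maximal : ∀ S → S ⊆ U → excess U h S ℤ.≤ excess U h A) (0<excess : 0ℤ ℤ.< excess U h A) where

    B : Subset n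
    B = U ─ A

    B⊆U : B ⊆ U
    B⊆U = p─q⊆p U A

    module OnA = Restriction U h A A⊆U
    module OnB = Restriction U h B B⊆U

    g : Subset n → ℤ
    g = excess U h

    g-symmetric : ∀ S → S ⊆ U → g S ≡ g (U ─ S)
    g-symmetric S S⊆U = cong₂ (λ z Z → z ℤ.- + ∣ Z ∣) (symmetric adm S S⊆U) (∂-complement U S)

    g-weaklySupermodular : WeaklySupermodularOn U g
    g-weaklySupermodular = weaklySupermodular-minus {h = h} {c = λ S → + ∣ ∂ U S ∣} (weaklySupermodular adm)
      (cut-stronglySubmodular (Eg ∩ inner ends U) ends U)

    tight-A : ∀ {w} → (∀ e → 0ᵣ ≲ w e) → CutRelaxed U h w → Tight U A w
    tight-A 0≲w cr = weight≲0⇒ 0≲w (≲-trans (cr A A⊆U)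
      (fromℤ-mono (ℤₚ.⊔-lub ℤₚ.≤-refl (ℤₚ.neg-mono-≤ (ℤₚ.<⇒≤ 0<excess)))))

    -- The cut of `S` is paid for by the cuts of `A ∩ S` in `A` and of `B ∩ S` in `B`. Uncrossing
    -- gives either `A ∩ S` with `A ∪ S`, the latter complementary to `B ─ (B ∩ S)`, or
    -- `A ─ (A ∩ S)` with `B ∩ S`. Either way one excess bounds the first cut and the other the
    -- second, and `combine-deficits` adds the two bounds.
    cutRelaxed-glue : ∀ {w} → (∀ e → 0ᵣ ≲ w e) → Tight U A w →
      CutRelaxed A OnA.restricted w → CutRelaxed B OnB.restricted w → CutRelaxed U h w
    cutRelaxed-glue {w} 0≲w tight crA crB S S⊆U =
      ≲-trans (weight-split 0≲w {U} {A} tight S)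
        (Sum.[_,_]′ {C = weight w (∂ A (A ∩ S)) ⊕ weight w (∂ B (B ∩ S)) ≲ fromℤ (0ℤ ℤ.⊔ ℤ.- g S)}
               (λ le → bound (A ∩ S) (A ∪ S) (⊆-trans (p∩q⊆p A S) A⊆U) (solve hyps (x :∪ y :⊆ a) ρ ps) le
                 (ℤₚ.i≤i⊔j (g (A ∩ S)) (g (A ─ (A ∩ S))))
                 (ℤₚ.i≤j⇒i≤k⊔j (g (B ∩ S)) (ℤₚ.≤-reflexive (trans
                   (g-symmetric (A ∪ S) (solve hyps (x :∪ y :⊆ a) ρ ps))
                   (cong g (solve≡ hyps (a :─ (x :∪ y)) ((a :─ x) :─ ((a :─ x) :∩ y)) ρ ps))))))
               (λ le → bound (A ─ S) (S ─ A) (⊆-trans (p─q⊆p A S) A⊆U) (⊆-trans (p─q⊆p S A) S⊆U) le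
                 (ℤₚ.i≤j⇒i≤k⊔j (g (A ∩ S)) (ℤₚ.≤-reflexive
                   (cong g (solve≡ hyps (x :─ y) (x :─ (x :∩ y)) ρ ps))))
                 (ℤₚ.i≤j⇒i≤j⊔k (g (B ─ (B ∩ S))) (ℤₚ.≤-reflexive
                   (cong g (solve≡ hyps (y :─ x) ((a :─ x) :∩ y) ρ ps)))))
             (g-weaklySupermodular A S A⊆U S⊆U))
      where
      ρ = U ∷ A ∷ S ∷ []
      hyps : List (Inclusion 3)
      hyps = (x :⊆ a) ∷ (y :⊆ a) ∷ []
      ps : All (Holds ρ) hyps
      ps = A⊆U ∷ S⊆U ∷ []
      bound : ∀ P Q → P ⊆ U → Q ⊆ U → g A ℤ.+ g S ℤ.≤ g P ℤ.+ g Q →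
        g P ℤ.≤ g (A ∩ S) ℤ.⊔ g (A ─ (A ∩ S)) → g Q ℤ.≤ g (B ∩ S) ℤ.⊔ g (B ─ (B ∩ S)) →
        weight w (∂ A (A ∩ S)) ⊕ weight w (∂ B (B ∩ S)) ≲ fromℤ (0ℤ ℤ.⊔ ℤ.- g S)
      bound P Q P⊆U Q⊆U le P≤ Q≤ = ≲-trans
        (⊕-mono-≲ (OnA.cutRelaxed-below crA (p∩q⊆p A S) P≤) (OnB.cutRelaxed-below crB (p∩q⊆p B S) Q≤))
        (≲-trans (fromℤ-homo-≳ (0ℤ ℤ.⊔ ℤ.- g P) (0ℤ ℤ.⊔ ℤ.- g Q))
          (fromℤ-mono (combine-deficits (ℤₚ.<⇒≤ 0<excess) (maximal P P⊆U) (maximal Q Q⊆U) le)))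

    module _ (DA : Decomposition A OnA.restricted) (DB : Decomposition B OnB.restricted) where

      module DA = Decomposition DA
      module DB = Decomposition DB

      -- The disjoint sum keeps the two families apart without arithmetic on `Fin`; this is why a
      -- decomposition may have any finite index type.
      Index : Set
      Index = DA.Index ⊎ DB.Index

      part : Index → Subset n
      part = Sum.[ DA.part , DB.part ]

      bound : Index → Subset n → ℤ
      bound = Sum.[ DA.bound , DB.bound ]

      B∌ : ∀ {v} → v ∈ A → v ∉ B
      B∌ v∈A v∈B = ∉⊥ (solve [] (x :∩ (a :─ x) :⊆ :⊥) (U ∷ A ∷ A ∷ []) [] (x∈p∩q⁺ (v∈A , v∈B)))

      disjoint : ∀ i j → i ≢ j → Empty (part i ∩ part j)
      disjoint (inj₁ i) (inj₁ j) i≢j = DA.disjoint i j (i≢j ∘ cong inj₁)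
      disjoint (inj₂ i) (inj₂ j) i≢j = DB.disjoint i j (i≢j ∘ cong inj₂)
      disjoint (inj₁ i) (inj₂ j) _ (v , v∈) =
        let v∈i , v∈j = x∈p∩q⁻ (DA.part i) (DB.part j) v∈
        in B∌ (DA.part⊆ i v∈i) (DB.part⊆ j v∈j)
      disjoint (inj₂ i) (inj₁ j) _ (v , v∈) =
        let v∈i , v∈j = x∈p∩q⁻ (DB.part i) (DA.part j) v∈
        in B∌ (DA.part⊆ j v∈j) (DB.part⊆ i v∈i)

      covers : ∀ v → v ∈ U → ∃[ i ] v ∈ part i
      covers v v∈U with v ∈? A
      ... | yes v∈A = let i , v∈i = DA.covers v v∈A in inj₁ i , v∈i
      ... | no  v∉A = let i , v∈i = DB.covers v (x∈p∧x∉q⇒x∈p─q v∈U v∉A) in inj₂ i , v∈i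

      split : ∀ {w} → (∀ e → 0ᵣ ≲ w e) → CutRelaxed U h w →
        ∀ i → Tight U (part i) w × Bounded (part i) (bound i) w
      split {w} 0≲w cr (inj₁ i) =
        let tight , bounded = DA.split 0≲w (OnA.restrict-cutRelaxed 0≲w cr) i
        in tight-extend (DA.part⊆ i) A⊆U (tight-A 0≲w cr) tight , bounded
      split {w} 0≲w cr (inj₂ i) =
        let tight , bounded = DB.split 0≲w (OnB.restrict-cutRelaxed 0≲w cr) i
        in tight-extend (DB.part⊆ i) B⊆U
             (subst (λ Z → ∀ e → e ∈ Z → w e ≲ 0ᵣ) (∂-complement U A) (tight-A 0≲w cr)) tight
         , bounded

      unsplit : ∀ {w} → (∀ e → 0ᵣ ≲ w e) →
        (∀ i → Tight U (part i) w × Bounded (part i) (bound i) w) → CutRelaxed U h w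
      unsplit {w} 0≲w parts = cutRelaxed-glue 0≲w tight
        (DA.unsplit 0≲w λ i →
          (λ e e∈ → proj₁ (parts (inj₁ i)) e (∂-mono A⊆U (DA.part i) e∈)) , proj₂ (parts (inj₁ i)))
        (DB.unsplit 0≲w λ i →
          (λ e e∈ → proj₁ (parts (inj₂ i)) e (∂-mono B⊆U (DB.part i) e∈)) , proj₂ (parts (inj₂ i)))
        where
        -- An edge leaving `A` has its end in `A` in some part of `A`; that part lies in `A`, so the
        -- edge leaves the part too.
        tight : Tight U A w
        tight e e∈ with x∈p∩q⁻ (Eg ∩ inner ends U) (crossing ends A) e∈
        ... | e∈U , e∈A with ∈-crossing⁻ ends A e∈A
        ...   | inj₁ (p , q) = let i , p∈i = DA.covers _ p in
          proj₁ (parts (inj₁ i)) e (x∈p∩q⁺ (e∈U ,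
            ∈-crossing⁺ ends (DA.part i) (inj₁ (p∈i , q ∘ DA.part⊆ i))))
        ...   | inj₂ (p , q) = let i , q∈i = DA.covers _ q in
          proj₁ (parts (inj₁ i)) e (x∈p∩q⁺ (e∈U ,
            ∈-crossing⁺ ends (DA.part i) (inj₂ (p ∘ DA.part⊆ i , q∈i))))

      decomposition : Decomposition U h
      decomposition = record
        { Index       = Index
        ; enumeration = (DA.enumeration ⊎-↔ DB.enumeration) ↔-∘ Finₚ.+↔⊎
        ; part        = part
        ; bound       = bound
        ; part⊆       = λ { (inj₁ i) → ⊆-trans (DA.part⊆ i) A⊆U ; (inj₂ i) → ⊆-trans (DB.part⊆ i) B⊆U }
        ; nonempty    = λ { (inj₁ i) → DA.nonempty i ; (inj₂ i) → DB.nonempty i }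
        ; disjoint    = disjoint
        ; covers      = covers
        ; admissible  = λ { (inj₁ i) → DA.admissible i ; (inj₂ i) → DB.admissible i }
        ; split       = split
        ; unsplit     = unsplit
        }

  -- Both halves are proper: normalization makes the excess of `⊥` and of `U` nonpositive, whereas
  -- that of `A` is positive. As `maximiser` ranges over all subsets of `Fin n`, its argument is
  -- intersected with `U`.
  decompose : ∀ {U h} → Acc ℕ._<_ ∣ U ∣ → Admissible U h → Decomposition U h
  decompose {U} {h} (acc smaller) adm with maximiser (λ S → excess U h (S ∩ U))
  ... | A′ , A′-max with 0ℤ ℤₚ.<? excess U h (A′ ∩ U)
  ...   | yes 0<excess = Split.decomposition adm A⊆U maximal 0<excess
            (decompose (smaller (p⊂q⇒∣p∣<∣q∣ A⊂U))
              (Restriction.restricted-admissible U h A A⊆U adm))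
            (decompose (smaller (p⊂q⇒∣p∣<∣q∣ B⊂U))
              (Restriction.restricted-admissible U h (U ─ A) (p─q⊆p U A) adm))
    where
    A : Subset _
    A = A′ ∩ U
    A⊆U : A ⊆ U
    A⊆U = p∩q⊆q A′ U
    maximal : ∀ S → S ⊆ U → excess U h S ℤ.≤ excess U h A
    maximal S S⊆U = subst (λ Z → excess U h Z ℤ.≤ excess U h A)
      (solve≡ ((x :⊆ a) ∷ []) (x :∩ a) x (U ∷ S ∷ S ∷ []) (S⊆U ∷ [])) (A′-max S)
    excess≤h : ∀ S → h S ≡ 0ℤ → excess U h S ℤ.≤ 0ℤ
    excess≤h S eq = subst (λ z → z ℤ.- + ∣ ∂ U S ∣ ℤ.≤ 0ℤ) (sym eq)
      (subst (ℤ._≤ 0ℤ) (sym (ℤₚ.+-identityˡ (ℤ.- + ∣ ∂ U S ∣))) (ℤₚ.neg-mono-≤ (ℤ.+≤+ ℕ.z≤n)))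
    A≢⊥ : A ≢ ⊥
    A≢⊥ eq = ℤₚ.<⇒≱ 0<excess (excess≤h A (trans (cong h eq) (proj₁ (normalized adm))))
    A≢U : A ≢ U
    A≢U eq = ℤₚ.<⇒≱ 0<excess (excess≤h A (trans (cong h eq) (proj₂ (normalized adm))))
    A-nonempty : Nonempty A
    A-nonempty with nonempty? A
    ... | yes ne = ne
    ... | no  ¬ne = contradiction (Empty-unique ¬ne) A≢⊥
    B-nonempty : Nonempty (U ─ A)
    B-nonempty with nonempty? (U ─ A)
    ... | yes ne = ne
    ... | no  ¬ne = contradiction
      (solve≡ ((x :⊆ a) ∷ (a :─ x :⊆ :⊥) ∷ []) x a (U ∷ A ∷ A ∷ [])
        (A⊆U ∷ ⊆-reflexive (Empty-unique ¬ne) ∷ [])) A≢U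
    A⊂U : A ⊂ U
    A⊂U = A⊆U , proj₁ B-nonempty , p─q⊆p U A (proj₂ B-nonempty)
        , λ v∈A → ∉⊥ (solve [] ((a :─ x) :∩ x :⊆ :⊥) (U ∷ A ∷ A ∷ []) []
            (x∈p∩q⁺ (proj₂ B-nonempty , v∈A)))
    B⊂U : U ─ A ⊂ U
    B⊂U = p─q⊆p U A , proj₁ A-nonempty , A⊆U (proj₂ A-nonempty)
        , λ v∈B → ∉⊥ (solve [] ((a :─ x) :∩ x :⊆ :⊥) (U ∷ A ∷ A ∷ []) []
            (x∈p∩q⁺ (v∈B , proj₂ A-nonempty)))
  ...   | no 0≮excess with nonempty? U
  ...     | no  empty = decomposition-empty empty
  ...     | yes ne    = decomposition-whole ne adm λ S S⊆U → ℤₚ.≤-trans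
    (subst (λ Z → excess U h Z ℤ.≤ excess U h (A′ ∩ U))
      (solve≡ ((x :⊆ a) ∷ []) (x :∩ a) x (U ∷ S ∷ S ∷ []) (S⊆U ∷ [])) (A′-max S))
    (ℤₚ.≮⇒≥ 0≮excess)

-- Feasible regions

x+complement : ∀ x n → seq (x ⊕ complement x) n ≡ 1ℚ
x+complement x n = trans (seq-⊕ x (complement x) n)
  (trans (cong (seq x n ℚ.+_) (seq-complement x n))
    (ℚ-solve 1 (λ x → x :+ (con 1ℚ :- x) := con 1ℚ) refl (seq x n)))
  where open ℚ-Solver.+-*-Solver renaming (solve to ℚ-solve)

1⊕0 : ∀ n → seq (1ᵣ ⊕ 0ᵣ) n ≡ 1ℚ
1⊕0 n = seq-⊕ 1ᵣ 0ᵣ n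

0≲complement : ∀ {x} → x ≲ 1ᵣ → 0ᵣ ≲ complement x
0≲complement {x} = ⊕-cancelˡ-≲ (pointwise≡⇒≲ {1ᵣ ⊕ 0ᵣ} {x ⊕ complement x} λ n →
  trans (1⊕0 n) (sym (x+complement x n)))

complement≲0⇒ : ∀ {x} → complement x ≲ 0ᵣ → 1ᵣ ≲ x
complement≲0⇒ {x} = ⊕-cancelˡ-≲ (≲-trans {y = 1ᵣ} (pointwise≡⇒≲ {0ᵣ ⊕ 1ᵣ} (0⊕ 1ᵣ))
  (≲-trans (pointwise≡⇒≲ {1ᵣ} {x ⊕ complement x} λ n → sym (x+complement x n))
    (⊕-comm-≲ x (complement x))))

complement≲0⇐ : ∀ {x} → 1ᵣ ≲ x → complement x ≲ 0ᵣ
complement≲0⇐ {x} = ⊕-cancelˡ-≲ (pointwise≡⇒≲ {x ⊕ complement x} {1ᵣ ⊕ 0ᵣ} λ n →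
  trans (x+complement x n) (sym (1⊕0 n)))

0≲1 : 0ᵣ ≲ 1ᵣ
0≲1 = fromℤ-mono {+ 0} {+ 1} (ℤ.+≤+ ℕ.z≤n)

slack : (Fin m → ℝ) → Fin m → ℝ
slack u e = complement (u e)

opaque
  unfolding ∑

  seq-sumᵣ-cong : {f g : Fin m → ℝ} → ∀ n → (∀ e → seq (f e) n ≡ seq (g e) n) →
    seq (sumᵣ f) n ≡ seq (∑ g) n
  seq-sumᵣ-cong {zero}  n f≡g = refl
  seq-sumᵣ-cong {suc m} n f≡g = cong₂ ℚ._+_ (f≡g zero) (seq-sumᵣ-cong n (λ e → f≡g (suc e)))

mask-∈ : ∀ {Z : Subset m} {e} x → e ∈ Z → mask (lookup Z e) x ≡ x
mask-∈ x e∈Z = cong (λ b → mask b x) ([]=⇒lookup e∈Z)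

mask-∉ : ∀ {Z : Subset m} {e} x → e ∉ Z → mask (lookup Z e) x ≡ 0ᵣ
mask-∉ x e∉Z = cong (λ b → mask b x) (∉⇒lookup e∉Z)

z+[d-z] : ∀ z d → z ℤ.+ (d ℤ.- z) ≡ d
z+[d-z] = ℤ-solve 2 (λ z d → z :+ (d :- z) := d) refl
  where open ℤ-Solver.+-*-Solver renaming (solve to ℤ-solve)

-- Connects sums over an edge set with irrelevant membership proofs to `weight`, which is defined
-- for functions on all labels.
module _ (D : Graph n m) (y : EdgeVector D) (u : Fin m → ℝ) (y≡u : ∀ e → y e ≡ u (value e)) where

  mutual

    seq-total : ∀ Z k → seq (total D y Z) k ≡ seq (weight u (value Z)) k
    seq-total Z k = seq-sumᵣ-cong k (seq-total-term Z k)

    -- The summand of total is local to its definition; the placeholder stands for it.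
    seq-total-term : ∀ Z k e → _ ≡ seq (mask (lookup (value Z) e) (u e)) k
    seq-total-term Z k e with e ∈? value Z
    ... | yes e∈Z = cong (λ z → seq z k) (trans (y≡u _) (sym (mask-∈ (u e) e∈Z)))
    ... | no  e∉Z = cong (λ z → seq z k) (sym (mask-∉ (u e) e∉Z))

  total-≲-weight : ∀ Z → total D y Z ≲ weight u (value Z)
  total-≲-weight Z = pointwise≡⇒≲ (seq-total Z)

  weight-≲-total : ∀ Z → weight u (value Z) ≲ total D y Z
  weight-≲-total Z = pointwise≡⇒≲ (λ k → sym (seq-total Z k))

  seq-total+slack : ∀ Z k →
    seq (total D y Z ⊕ weight (slack u) (value Z)) k ≡ seq (fromℤ (+ ∣ value Z ∣)) k
  seq-total+slack Z k = begin
    seq (total D y Z ⊕ weight (slack u) (value Z)) k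
      ≡⟨ seq-⊕ (total D y Z) (weight (slack u) (value Z)) k ⟩
    seq (total D y Z) k ℚ.+ seq (weight (slack u) (value Z)) k
      ≡⟨ cong (ℚ._+ seq (weight (slack u) (value Z)) k) (seq-total Z k) ⟩
    seq (weight u (value Z)) k ℚ.+ seq (weight (slack u) (value Z)) k
      ≡⟨ weight-complement u (value Z) k ⟨
    seq (fromℤ (+ ∣ value Z ∣)) k ∎
    where open ≡-Reasoning

  total+slack-≲ : ∀ Z → total D y Z ⊕ weight (slack u) (value Z) ≲ fromℤ (+ ∣ value Z ∣)
  total+slack-≲ Z = pointwise≡⇒≲ (seq-total+slack Z)

  total+slack-≳ : ∀ Z → fromℤ (+ ∣ value Z ∣) ≲ weight (slack u) (value Z) ⊕ total D y Z
  total+slack-≳ Z = ≲-trans {y = total D y Z ⊕ weight (slack u) (value Z)}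
    (pointwise≡⇒≲ (λ k → sym (seq-total+slack Z k)))
    (⊕-comm-≲ (total D y Z) (weight (slack u) (value Z)))

  ≲total⇒slack≲ : ∀ Z z → fromℤ z ≲ total D y Z →
    weight (slack u) (value Z) ≲ fromℤ (+ ∣ value Z ∣ ℤ.- z)
  ≲total⇒slack≲ Z z z≲total = ⊕-cancelˡ-≲
    {total D y Z} {weight (slack u) (value Z)} {fromℤ z} {fromℤ (+ ∣ value Z ∣ ℤ.- z)}
    (≲-trans (total+slack-≲ Z)
    (≲-trans (fromℤ-mono (ℤₚ.≤-reflexive (sym (z+[d-z] z (+ ∣ value Z ∣)))))
             (fromℤ-homo-≲ z (+ ∣ value Z ∣ ℤ.- z)))) z≲total

  slack≲⇒≲total : ∀ Z c → weight (slack u) (value Z) ≲ fromℤ c →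
    fromℤ (+ ∣ value Z ∣ ℤ.- c) ≲ total D y Z
  slack≲⇒≲total Z c slack≲c = ⊕-cancelˡ-≲
    {fromℤ c} {fromℤ (+ ∣ value Z ∣ ℤ.- c)} {weight (slack u) (value Z)} {total D y Z}
    (≲-trans (fromℤ-homo-≳ c (+ ∣ value Z ∣ ℤ.- c))
    (≲-trans (fromℤ-mono (ℤₚ.≤-reflexive (z+[d-z] c (+ ∣ value Z ∣)))) (total+slack-≳ Z))) slack≲c

d-z≡-[z-d] : ∀ z d → d ℤ.- z ≡ ℤ.- (z ℤ.- d)
d-z≡-[z-d] = ℤ-solve 2 (λ z d → d :- z := :- (z :- d)) refl
  where open ℤ-Solver.+-*-Solver renaming (solve to ℤ-solve)

d-[d-z] : ∀ z d → d ℤ.- (ℤ.- (z ℤ.- d)) ≡ z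
d-[d-z] = ℤ-solve 2 (λ z d → d :- (:- (z :- d)) := z) refl
  where open ℤ-Solver.+-*-Solver renaming (solve to ℤ-solve)

-- With `z` the requirement and `d` the degree, this turns the minimum in (CRLP) into the truncated
-- negative excess.
d-z⊓d : ∀ z d → d ℤ.- (z ℤ.⊓ d) ≡ 0ℤ ℤ.⊔ ℤ.- (z ℤ.- d)
d-z⊓d z d with ℤₚ.≤-total z d
... | inj₁ z≤d = trans (cong (λ c → d ℤ.- c) (ℤₚ.i≤j⇒i⊓j≡i z≤d)) (trans (d-z≡-[z-d] z d)
  (sym (ℤₚ.i≤j⇒i⊔j≡j (ℤₚ.neg-mono-≤ (ℤₚ.i≤j⇒i-j≤0 z≤d)))))
... | inj₂ d≤z = trans (cong (λ c → d ℤ.- c) (ℤₚ.i≥j⇒i⊓j≡j d≤z)) (trans (ℤₚ.+-inverseʳ d)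
  (sym (ℤₚ.i≥j⇒i⊔j≡i (subst (ℤ._≤ 0ℤ) (d-z≡-[z-d] z d) (ℤₚ.i≤j⇒i-j≤0 d≤z)))))

d-[d-z⊓d] : ∀ z d → d ℤ.- (0ℤ ℤ.⊔ ℤ.- (z ℤ.- d)) ≡ z ℤ.⊓ d
d-[d-z⊓d] z d = trans (cong (λ c → d ℤ.- c) (sym (d-z⊓d z d)))
  (trans (cong (λ c → d ℤ.- c) (d-z≡-[z-d] (z ℤ.⊓ d) d)) (d-[d-z] (z ℤ.⊓ d) d))

module _ {U : Subset n} where

  -- The stored proof is irrelevant, so a usable one is recovered by deciding the inclusion.
  inclusion : (S : 2^ U) → value S ⊆ U
  inclusion (S , [ S⊆U ]) = recompute (S ⊆? U) S⊆U

  -- S ∩ U rather than S, so that h is defined on all subsets of Fin n.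
  extendSet : (2^ U → ℤ) → Subset n → ℤ
  extendSet h S = h (S ∩ U , [ p∩q⊆q S U ])

  extendSet-≡ : ∀ h S (T : 2^ U) → S ≡ value T → extendSet h S ≡ h T
  extendSet-≡ h S T refl = cong h (value-injective
    (solve≡ ((x :⊆ a) ∷ []) (x :∩ a) x (U ∷ S ∷ S ∷ []) (inclusion T ∷ [])))

≤⊔⇒⊎ : ∀ {z p q} → z ℤ.≤ p ℤ.⊔ q → z ℤ.≤ p ⊎ z ℤ.≤ q
≤⊔⇒⊎ {z} {p} {q} z≤ = Sum.map (λ eq → subst (z ℤ.≤_) eq z≤) (λ eq → subst (z ℤ.≤_) eq z≤) (ℤₚ.⊔-sel p q)

⊎⇒≤⊔ : ∀ {z p q} → z ℤ.≤ p ⊎ z ℤ.≤ q → z ℤ.≤ p ℤ.⊔ q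
⊎⇒≤⊔ {z} {p} {q} = Sum.[ ℤₚ.i≤j⇒i≤j⊔k q , ℤₚ.i≤j⇒i≤k⊔j p ]

module _ (G : Graph n m) (f : 2^ V G → ℤ) where

  open Decompositions (E G) (ends G)

  extendSet-admissible : WeaklySupermodular f → Symmetric f → Normalized f →
    Admissible (V G) (extendSet f)
  extendSet-admissible wsm symm norm = record
    { weaklySupermodular = λ X Y X⊆V Y⊆V → let A = X , [ X⊆V ] ; B = Y , [ Y⊆V ] in
        subst (λ z → Uncrosses f̂ z X Y)
          (sym (cong₂ ℤ._+_ (extendSet-≡ f X A refl) (extendSet-≡ f Y B refl)))
          (Sum.map
            (subst (_ ℤ.≤_) (sym (cong₂ ℤ._+_
              (extendSet-≡ f (X ∩ Y) (A ⊓ B) refl) (extendSet-≡ f (X ∪ Y) (A ⊔ B) refl))))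
            (subst (_ ℤ.≤_) (sym (cong₂ ℤ._+_
              (extendSet-≡ f (X ─ Y) (A ∖ B) refl) (extendSet-≡ f (Y ─ X) (B ∖ A) refl))))
            (≤⊔⇒⊎ (wsm A B)))
    ; symmetric  = λ X X⊆V → let A = X , [ X⊆V ] in
        trans (extendSet-≡ f X A refl) (trans (symm A) (sym (extendSet-≡ f (V G ─ X) (full ∖ A) refl)))
    ; normalized = trans (extendSet-≡ f ⊥ ∅ refl) (proj₁ norm)
                 , trans (extendSet-≡ f (V G) full refl) (proj₂ norm)
    }
    where f̂ = extendSet f

module _ (D : Graph n m) where

  -- The value 1 outside E makes slack vanish there.
  extend : EdgeVector D → Fin m → ℝ
  extend x e with e ∈? E D
  ... | yes e∈E = x (e , [ e∈E ])
  ... | no  _   = 1ᵣ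

  extend-value : ∀ x e → x e ≡ extend x (value e)
  extend-value x (e , [ e∈E ]) with e ∈? E D
  ... | yes _   = refl
  ... | no  e∉E = contradiction-irr e∈E e∉E

  -- Serves in place of function extensionality: the totals of `y` and `z` are compared with the
  -- weight of one common extension.
  RegionNDP-cong : ∀ h {y z : EdgeVector D} → (∀ e → y e ≡ z e) → RegionNDP D h y → RegionNDP D h z
  RegionNDP-cong h {y} {z} y≡z (constraints , unit) =
      (λ S → ⌞ ≲-trans {fromℤ (h S)} {total D y (δ D S)} {total D z (δ D S)} ⌜ constraints S ⌝
        (≲-trans {y = weight (extend y) (value (δ D S))}
          (total-≲-weight D y (extend y) (extend-value y) (δ D S))
          (weight-≲-total D z (extend y) (λ e → trans (sym (y≡z e)) (extend-value y e)) (δ D S))) ⌟)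
    , λ e → subst (λ r → 0ᵣ ≤ᵣ r × r ≤ᵣ 1ᵣ) (y≡z e) (unit e)

-- Characteristic vectors of edge sets

indicator : Subset m → Fin m → ℝ
indicator F e = mask (lookup F e) 1ᵣ

seq-weight-indicator : ∀ (Z F : Subset m) k →
  seq (weight (indicator F) Z) k ≡ seq (fromℤ (+ ∣ Z ∩ F ∣)) k
seq-weight-indicator []      []      k = seq-∑-zero _ k
seq-weight-indicator (b ∷ Z) (c ∷ F) k = trans (seq-∑-suc _ k)
  (trans (cong (seq (mask b (mask c 1ᵣ)) k ℚ.+_) (seq-weight-indicator Z F k)) (head b c))
  where
  head : ∀ b c → seq (mask b (mask c 1ᵣ)) k ℚ.+ seq (fromℤ (+ ∣ Z ∩ F ∣)) k ≡
    seq (fromℤ (+ ∣ (b ∷ Z) ∩ (c ∷ F) ∣)) k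
  head true  true  = sym (/1-homo-+ (+ 1) (+ ∣ Z ∩ F ∣))
  head true  false = ℚₚ.+-identityˡ _
  head false _     = ℚₚ.+-identityˡ _

module _ (D : Graph n m) (H : 2^ E D) (y : EdgeVector D)
  (y≡ : ∀ e → y e ≡ indicator (value H) (value e)) where

  -- The total is the constant sequence of an integer, so the real inequality reduces to an integral
  -- one.
  ≤total⇔≤∣∣ : ∀ Z z → fromℤ z ≤ᵣ total D y Z ⇔ z ℤ.≤ + ∣ value (Z ⊓ H) ∣
  ≤total⇔≤∣∣ Z z = mk⇔
    (λ le → fromℤ-cancel (≲-trans {y = total D y Z} ⌜ le ⌝ (pointwise≡⇒≲ seq-count)))
    (λ le → ⌞ ≲-trans {fromℤ z} {fromℤ (+ ∣ value Z ∩ value H ∣)} {total D y Z} (fromℤ-mono le)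
                (pointwise≡⇒≲ (λ k → sym (seq-count k))) ⌟)
    where
    seq-count : ∀ k → seq (total D y Z) k ≡ seq (fromℤ (+ ∣ value Z ∩ value H ∣)) k
    seq-count k = trans (seq-total D y (indicator (value H)) y≡ Z k)
      (seq-weight-indicator (value Z) (value H) k)

  indicator-unit : ∀ e → 0ᵣ ≤ᵣ y e × y e ≤ᵣ 1ᵣ
  indicator-unit e = subst (λ r → 0ᵣ ≤ᵣ r × r ≤ᵣ 1ᵣ) (sym (y≡ e)) (mask-unit (lookup (value H) (value e)))
    where
    mask-unit : ∀ b → 0ᵣ ≤ᵣ mask b 1ᵣ × mask b 1ᵣ ≤ᵣ 1ᵣ
    mask-unit true  = ⌞ 0≲1 ⌟ , ⌞ ≲-refl {1ᵣ} ⌟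
    mask-unit false = ⌞ ≲-refl {0ᵣ} ⌟ , ⌞ 0≲1 ⌟

  feasible⇔region : ∀ h → FeasibleNDP D h H ⇔ RegionNDP D h y
  feasible⇔region h = mk⇔
    (λ feas → (λ S → Equivalence.from (≤total⇔≤∣∣ (δ D S) (h S)) (feas S)) , indicator-unit)
    (λ region S → Equivalence.to (≤total⇔≤∣∣ (δ D S) (h S)) (proj₁ region S))

  feasibleCR⇔region : ∀ h → FeasibleCRNDP D h H ⇔ RegionCRLP D h y
  feasibleCR⇔region h = mk⇔
    (λ feas → (λ S → Equivalence.from (≤total⇔≤∣∣ (δ D S) (crBound D h S)) (feas S)) , indicator-unit)
    (λ region S → Equivalence.to (≤total⇔≤∣∣ (δ D S) (crBound D h S)) (proj₁ region S))

convex-self : ∀ t x → x ≈ᵣ t *ᵣ x +ᵣ (1ᵣ -ᵣ t) *ᵣ x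
convex-self t x = ≲-antisym {x} {t *ᵣ x +ᵣ (1ᵣ -ᵣ t) *ᵣ x}
  (pointwise≡⇒≲ (λ n → convex (seq t n) (seq x n)))
  (pointwise≡⇒≲ (λ n → sym (convex (seq t n) (seq x n))))
  where
  open ℚ-Solver.+-*-Solver renaming (solve to ℚ-solve)
  convex : ∀ t x → x ≡ t ℚ.* x ℚ.+ (1ℚ ℚ.- t) ℚ.* x
  convex = ℚ-solve 2 (λ t x → x := t :* x :+ (con 1ℚ :- t) :* x) refl

-- From decompositions to the regions of the graph and its parts

module Transfer (G : Graph n m) (f : 2^ V G → ℤ)
  (𝒟 : Decompositions.Decomposition (E G) (ends G) (V G) (extendSet f)) where

  open Decompositions (E G) (ends G)
  open Cuts (E G) (ends G)
  open Decomposition 𝒟 public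

  f̂ : Subset n → ℤ
  f̂ = extendSet f

  index : Fin size → Index
  index = Inverse.to enumeration

  position : Index → Fin size
  position = Inverse.from enumeration

  position∘index : ∀ i → position (index i) ≡ i
  position∘index = Inverse.strictlyInverseʳ enumeration

  index∘position : ∀ i → index (position i) ≡ i
  index∘position = Inverse.strictlyInverseˡ enumeration

  P : Fin size → 2^ V G
  P i = part (index i) , [ part⊆ (index i) ]

  fs : (i : Fin size) → 2^ V (G ⟨ P i ⟩) → ℤ
  fs i S = bound (index i) (value S)

  P-disjoint : ∀ i j → i ≢ j → Empty (value (P i) ∩ value (P j))
  P-disjoint i j i≢j = disjoint (index i) (index j) λ eq →
    i≢j (trans (sym (position∘index i)) (trans (cong position eq) (position∘index j)))

  P-covers : ∀ v → v ∈ V G → ∃[ i ] v ∈ value (P i)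
  P-covers v v∈V = let i , v∈i = covers v v∈V in
    position i , subst (λ i → v ∈ part i) (sym (index∘position i)) v∈i

  P-isPartition : IsPartition P
  P-isPartition = record { nonempty = nonempty ∘ index ; disjoint = P-disjoint ; covers = P-covers }

  fs-admissible : ∀ i → WeaklySupermodular (fs i) × Symmetric (fs i) × Normalized (fs i)
  fs-admissible i =
      (λ A B → ⊎⇒≤⊔ (Admissible.weaklySupermodular adm (value A) (value B) (inclusion A) (inclusion B)))
    , (λ S → Admissible.symmetric adm (value S) (inclusion S))
    , Admissible.normalized adm
    where adm = admissible (index i)

  E∩inner≡E : E G ∩ inner (ends G) (V G) ≡ E G
  E∩inner≡E = ⊆-antisym (p∩q⊆p (E G) (inner (ends G) (V G))) λ e∈E →
    x∈p∩q⁺ (e∈E , ∈-inner⁺ (ends G) (V G) (proj₁ (incident G e∈E)) (proj₂ (incident G e∈E)))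

  δ≡∂ : ∀ S → value (δ G S) ≡ ∂ (V G) (value S)
  δ≡∂ S = cong (_∩ crossing (ends G) (value S)) (sym E∩inner≡E)

  -- Take the part containing the first end. Every coordinate of a vector is thus controlled by one
  -- part, either as an inner edge or as a forced one.
  inside⊎crossing : ∀ {e} → e ∈ E G → ∃[ i ] (e ∈ E (G ⟨ P i ⟩) ⊎ e ∈ value (δ G (P i)))
  inside⊎crossing {e} e∈E with P-covers (proj₁ (ends G e)) (proj₁ (incident G e∈E))
  ... | i , p with proj₂ (ends G e) ∈? value (P i)
  ...   | yes q = i , inj₁ (x∈p∩q⁺ (e∈E , ∈-inner⁺ (ends G) (value (P i)) p q))
  ...   | no ¬q = i , inj₂ (x∈p∩q⁺ (e∈E , ∈-crossing⁺ (ends G) (value (P i)) (inj₁ (p , ¬q))))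

  module _ (x : EdgeVector G) where

    w : Fin m → ℝ
    w = slack (extend G x)

    Unit : Set
    Unit = ∀ e → 0ᵣ ≤ᵣ x e × x e ≤ᵣ 1ᵣ

    TightOn : Fin size → Set
    TightOn i = ∀ (e : Elem (E G)) → value e ∈ value (δ G (P i)) → x e ≈ᵣ 1ᵣ

    0≲w : Unit → ∀ e → 0ᵣ ≲ w e
    0≲w unit e = 0≲complement (extend≲1 e)
      where
      extend≲1 : ∀ e → extend G x e ≲ 1ᵣ
      extend≲1 e with e ∈? E G
      ... | yes e∈E = ⌜ proj₂ (unit (e , [ e∈E ])) ⌝
      ... | no  _   = ≲-refl

    cutRelaxed⇒ : (∀ S → fromℤ (crBound G f S) ≤ᵣ total G x (δ G S)) → CutRelaxed (V G) f̂ w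
    cutRelaxed⇒ c S S⊆V = subst₂ (λ Z z → weight w Z ≲ fromℤ (0ℤ ℤ.⊔ ℤ.- (z ℤ.- + ∣ Z ∣)))
      (δ≡∂ A) (sym (extendSet-≡ f S A refl))
      (subst (λ c → weight w (value (δ G A)) ≲ fromℤ c) (d-z⊓d (f A) (+ ∣ value (δ G A) ∣))
        (≲total⇒slack≲ G x (extend G x) (extend-value G x) (δ G A) (crBound G f A) ⌜ c A ⌝))
      where
      A : 2^ V G
      A = S , [ S⊆V ]

    cutRelaxed⇐ : CutRelaxed (V G) f̂ w → ∀ S → fromℤ (crBound G f S) ≤ᵣ total G x (δ G S)
    cutRelaxed⇐ cr S = ⌞ subst (λ c → fromℤ c ≲ total G x (δ G S))
      (d-[d-z⊓d] (f S) (+ ∣ value (δ G S) ∣))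
      (slack≲⇒≲total G x (extend G x) (extend-value G x) (δ G S) (0ℤ ℤ.⊔ ℤ.- (f S ℤ.- + ∣ value (δ G S) ∣))
        (subst₂ (λ Z z → weight w Z ≲ fromℤ (0ℤ ℤ.⊔ ℤ.- (z ℤ.- + ∣ Z ∣)))
          (sym (δ≡∂ S)) (extendSet-≡ f (value S) S refl) (cr (value S) (inclusion S)))) ⌟

    module _ (i : Fin size) where

      restrict-value : ∀ e → restrict G x (P i) e ≡ extend G x (value e)
      restrict-value e = extend-value G x (Refinement.refine (p∩q⊆p (E G) (inner (ends G) (value (P i)))) e)

      bounded⇒ : Bounded (value (P i)) (bound (index i)) w →
        ∀ S → fromℤ (fs i S) ≤ᵣ total (G ⟨ P i ⟩) (restrict G x (P i)) (δ (G ⟨ P i ⟩) S)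
      bounded⇒ b S = ⌞ subst (λ c → fromℤ c ≲ total (G ⟨ P i ⟩) (restrict G x (P i)) (δ (G ⟨ P i ⟩) S))
        (d-[d-z] (fs i S) (+ ∣ value (δ (G ⟨ P i ⟩) S) ∣))
        (slack≲⇒≲total (G ⟨ P i ⟩) (restrict G x (P i)) (extend G x) restrict-value
          (δ (G ⟨ P i ⟩) S) (ℤ.- (fs i S ℤ.- + ∣ value (δ (G ⟨ P i ⟩) S) ∣))
          (b (value S) (inclusion S))) ⌟

      bounded⇐ : (∀ S → fromℤ (fs i S) ≤ᵣ total (G ⟨ P i ⟩) (restrict G x (P i)) (δ (G ⟨ P i ⟩) S)) →
        Bounded (value (P i)) (bound (index i)) w
      bounded⇐ c S S⊆P = subst (λ c → weight w (∂ (value (P i)) S) ≲ fromℤ c)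
        (d-z≡-[z-d] (bound (index i) S) (+ ∣ ∂ (value (P i)) S ∣))
        (≲total⇒slack≲ (G ⟨ P i ⟩) (restrict G x (P i)) (extend G x) restrict-value
          (δ (G ⟨ P i ⟩) A) (fs i A) ⌜ c A ⌝)
        where
        A : 2^ value (P i)
        A = S , [ S⊆P ]

      tight⇒ : Unit → Tight (V G) (value (P i)) w → TightOn i
      tight⇒ unit tight e e∈δ = ≲-antisym ⌜ proj₂ (unit e) ⌝
        (subst (1ᵣ ≲_) (sym (extend-value G x e))
          (complement≲0⇒ (tight (value e) (subst (value e ∈_) (δ≡∂ (P i)) e∈δ))))

      tight⇐ : TightOn i → Tight (V G) (value (P i)) w
      tight⇐ tight e e∈∂ = complement≲0⇐ (subst (1ᵣ ≲_) (extend-value G x ê)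
        (≈⇒≳ {x ê} {1ᵣ} (tight ê (subst (e ∈_) (sym (δ≡∂ (P i))) e∈∂))))
        where
        ê : Elem (E G)
        ê = e , [ p∩q⊆p (E G) _ (subst (e ∈_) (sym (δ≡∂ (P i))) e∈∂) ]

    region⇒ : RegionCRLP G f x → ∀ i → TightOn i × RegionNDP (G ⟨ P i ⟩) (fs i) (restrict G x (P i))
    region⇒ (c , unit) i = let tight , bounded = split (0≲w unit) (cutRelaxed⇒ c) (index i) in
      tight⇒ i unit tight , bounded⇒ i bounded
        , λ e → unit (Refinement.refine (p∩q⊆p (E G) (inner (ends G) (value (P i)))) e)

    region⇐ : (∀ i → TightOn i × RegionNDP (G ⟨ P i ⟩) (fs i) (restrict G x (P i))) → RegionCRLP G f x
    region⇐ parts = cutRelaxed⇐ (unsplit (0≲w unit) partsAt) , unit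
      where
      unit : Unit
      unit ê@(e , [ e∈E ]) = let i , case = inside⊎crossing (recompute (e ∈? E G) e∈E) in unitAt i case
        where
        unitAt : ∀ i → e ∈ E (G ⟨ P i ⟩) ⊎ e ∈ value (δ G (P i)) → 0ᵣ ≤ᵣ x ê × x ê ≤ᵣ 1ᵣ
        unitAt i (inj₁ e∈i) = proj₂ (proj₂ (parts i)) (e , [ e∈i ])
        unitAt i (inj₂ e∈δ) = ⌞ ≲-trans 0≲1 (≈⇒≳ {x ê} {1ᵣ} x≈1) ⌟ , ⌞ ≈⇒≲ {x ê} {1ᵣ} x≈1 ⌟
          where
          x≈1 : x ê ≈ᵣ 1ᵣ
          x≈1 = proj₁ (parts i) ê e∈δ
      partsAt : ∀ j → Tight (V G) (part j) w × Bounded (part j) (bound j) w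
      partsAt j = subst (λ j → Tight (V G) (part j) w × Bounded (part j) (bound j) w) (index∘position j)
        (tight⇐ (position j) (proj₁ (parts (position j)))
        , bounded⇐ (position j) (proj₁ (proj₂ (parts (position j)))))

  -- Extreme points

  refineAt : ∀ i → Elem (E (G ⟨ P i ⟩)) → Elem (E G)
  refineAt i = Refinement.refine (p∩q⊆p (E G) (inner (ends G) (value (P i))))

  ends∈P : ∀ i {e} → e ∈ E (G ⟨ P i ⟩) → proj₁ (ends G e) ∈ value (P i) × proj₂ (ends G e) ∈ value (P i)
  ends∈P i e∈ = ∈-inner (ends G) (value (P i)) (proj₂ (x∈p∩q⁻ (E G) _ e∈))

  inside-disjoint : ∀ {i j} → i ≢ j → ∀ {e} → e ∈ E (G ⟨ P i ⟩) → e ∉ E (G ⟨ P j ⟩)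
  inside-disjoint {i} {j} i≢j e∈i e∈j =
    P-disjoint i j i≢j (_ , x∈p∩q⁺ (proj₁ (ends∈P i e∈i) , proj₁ (ends∈P j e∈j)))

  -- Both ends lie in part `i`, hence both in part `j` if `i = j` and neither otherwise. Changing
  -- inner coordinates therefore leaves the forced ones alone.
  inside-not-crossing : ∀ i j {e} → e ∈ value (δ G (P j)) → e ∉ E (G ⟨ P i ⟩)
  inside-not-crossing i j {e} e∈δ e∈i with i Finₚ.≟ j | ends∈P i e∈i
    | ∈-crossing⁻ (ends G) (value (P j)) (proj₂ (x∈p∩q⁻ (E G) _ e∈δ))
  ... | yes refl | p , q | inj₁ (_ , ¬q) = ¬q q
  ... | yes refl | p , q | inj₂ (¬p , _) = ¬p p
  ... | no  i≢j  | p , q | inj₁ (p′ , _) = P-disjoint i j i≢j (_ , x∈p∩q⁺ (p , p′))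
  ... | no  i≢j  | p , q | inj₂ (_ , q′) = P-disjoint i j i≢j (_ , x∈p∩q⁺ (q , q′))

  Parts : EdgeVector G → Set
  Parts x = ∀ i → TightOn x i × RegionNDP (G ⟨ P i ⟩) (fs i) (restrict G x (P i))

  module Splice (x : EdgeVector G) (i : Fin size) where

    splice : EdgeVector (G ⟨ P i ⟩) → EdgeVector G
    splice y ê with value ê ∈? E (G ⟨ P i ⟩)
    ... | yes e∈i = y (value ê , [ e∈i ])
    ... | no  _   = x ê

    splice-inside : ∀ y e → splice y (refineAt i e) ≡ y e
    splice-inside y (e , [ e∈i ]) with e ∈? E (G ⟨ P i ⟩)
    ... | yes _   = refl
    ... | no  e∉i = contradiction-irr e∈i e∉i

    splice-outside : ∀ y ê → value ê ∉ E (G ⟨ P i ⟩) → splice y ê ≡ x ê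
    splice-outside y ê e∉i with value ê ∈? E (G ⟨ P i ⟩)
    ... | yes e∈i = contradiction e∈i e∉i
    ... | no  _   = refl

    -- The conditions decouple: on part `i` the spliced vector is `y`, while on the other parts and
    -- on all cuts it is `x`.
    splice-region : Parts x → ∀ y → RegionNDP (G ⟨ P i ⟩) (fs i) y → RegionCRLP G f (splice y)
    splice-region parts y Qy = region⇐ (splice y) λ j → tight j , region j (i Finₚ.≟ j)
      where
      tight : ∀ j → TightOn (splice y) j
      tight j ê e∈δ = subst (_≈ᵣ 1ᵣ) (sym (splice-outside y ê (inside-not-crossing i j e∈δ)))
        (proj₁ (parts j) ê e∈δ)
      region : ∀ j → Dec (i ≡ j) → RegionNDP (G ⟨ P j ⟩) (fs j) (restrict G (splice y) (P j))
      region j (yes refl) = RegionNDP-cong (G ⟨ P i ⟩) (fs i) (λ e → sym (splice-inside y e)) Qy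
      region j (no i≢j)   = RegionNDP-cong (G ⟨ P j ⟩) (fs j)
        (λ { (e , [ e∈j ]) → sym (splice-outside y (refineAt j (e , [ e∈j ]))
          λ e∈i → inside-disjoint i≢j e∈i (recompute (e ∈? E (G ⟨ P j ⟩)) e∈j)) })
        (proj₂ (parts j))

    splice-convex : ∀ y z t → (∀ e → restrict G x (P i) e ≈ᵣ t *ᵣ y e +ᵣ (1ᵣ -ᵣ t) *ᵣ z e) →
      ∀ ê → x ê ≈ᵣ t *ᵣ splice y ê +ᵣ (1ᵣ -ᵣ t) *ᵣ splice z ê
    splice-convex y z t convex ê = cases (value ê ∈? E (G ⟨ P i ⟩))
      where
      cases : Dec (value ê ∈ E (G ⟨ P i ⟩)) → x ê ≈ᵣ t *ᵣ splice y ê +ᵣ (1ᵣ -ᵣ t) *ᵣ splice z ê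
      cases (yes e∈i) = subst₂ (λ a b → x ê ≈ᵣ t *ᵣ a +ᵣ (1ᵣ -ᵣ t) *ᵣ b)
        (sym (splice-inside y (value ê , [ e∈i ]))) (sym (splice-inside z (value ê , [ e∈i ])))
        (convex (value ê , [ e∈i ]))
      cases (no e∉i) = subst₂ (λ a b → x ê ≈ᵣ t *ᵣ a +ᵣ (1ᵣ -ᵣ t) *ᵣ b)
        (sym (splice-outside y ê e∉i)) (sym (splice-outside z ê e∉i)) (convex-self t (x ê))

  extreme⇒ : ∀ x → ExtremePoint (RegionCRLP G f) x →
    ∀ i → TightOn x i × ExtremePoint (RegionNDP (G ⟨ P i ⟩) (fs i)) (restrict G x (P i))
  extreme⇒ x (Qx , unique) i = proj₁ (region⇒ x Qx i) , proj₂ (region⇒ x Qx i) ,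
    λ y z t Qy Qz 0<t t<1 convex →
      let y≈x , z≈x = unique (splice y) (splice z) t
            (splice-region (region⇒ x Qx) y Qy) (splice-region (region⇒ x Qx) z Qz) 0<t t<1
            (splice-convex y z t convex)
      in (λ e → subst (_≈ᵣ restrict G x (P i) e) (splice-inside y e) (y≈x (refineAt i e)))
       , (λ e → subst (_≈ᵣ restrict G x (P i) e) (splice-inside z e) (z≈x (refineAt i e)))
    where open Splice x i

  -- A convex representation of `x` restricts to one on each part, where it is trivial; on the
  -- forced edges both points and `x` are 1.
  extreme⇐ : ∀ x → (∀ i → TightOn x i × ExtremePoint (RegionNDP (G ⟨ P i ⟩) (fs i)) (restrict G x (P i))) →
    ExtremePoint (RegionCRLP G f) x
  extreme⇐ x parts = region⇐ x (λ i → proj₁ (parts i) , proj₁ (proj₂ (parts i))) ,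
    λ y z t Qy Qz 0<t t<1 convex →
      let agree = λ i → proj₂ (proj₂ (parts i)) (restrict G y (P i)) (restrict G z (P i)) t
                    (proj₂ (region⇒ y Qy i)) (proj₂ (region⇒ z Qz i)) 0<t t<1 (convex ∘ refineAt i)
      in glue y Qy (proj₁ ∘ agree) , glue z Qz (proj₂ ∘ agree)
    where
    glue : ∀ y → RegionCRLP G f y →
      (∀ i e → restrict G y (P i) e ≈ᵣ restrict G x (P i) e) → ∀ ê → y ê ≈ᵣ x ê
    glue y Qy agree ê@(e , [ e∈E ]) = let i , case = inside⊎crossing (recompute (e ∈? E G) e∈E) in at i case
      where
      at : ∀ i → e ∈ E (G ⟨ P i ⟩) ⊎ e ∈ value (δ G (P i)) → y ê ≈ᵣ x ê
      at i (inj₁ e∈i) = agree i (e , [ e∈i ])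
      at i (inj₂ e∈δ) = ≲-antisym {y ê} {x ê}
        (≲-trans {y = 1ᵣ} (≈⇒≲ {y ê} {1ᵣ} y≈1) (≈⇒≳ {x ê} {1ᵣ} x≈1))
        (≲-trans {y = 1ᵣ} (≈⇒≲ {x ê} {1ᵣ} x≈1) (≈⇒≳ {y ê} {1ᵣ} y≈1))
        where
        y≈1 : y ê ≈ᵣ 1ᵣ
        y≈1 = proj₁ (region⇒ y Qy i) ê e∈δ
        x≈1 : x ê ≈ᵣ 1ᵣ
        x≈1 = proj₁ (parts i) ê e∈δ

  -- Integral solutions

  module _ (F : 2^ E G) where

    χ : EdgeVector G
    χ e = indicator (value F) (value e)

    χ-restrict : ∀ i e → restrict G χ (P i) e ≡ indicator (value (edgesWithin G F (P i))) (value e)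
    χ-restrict i (e , [ e∈ ]) = cong (λ b → mask b 1ᵣ) (sym (trans
      (lookup-zipWith _∧_ e (value F) (inner (ends G) (value (P i))))
      (trans (cong (lookup (value F) e ∧_)
        ([]=⇒lookup (proj₂ (x∈p∩q⁻ (E G) _ (recompute (e ∈? E (G ⟨ P i ⟩)) e∈)))))
        (∧-identityʳ (lookup (value F) e)))))

    tight-χ⇒ : ∀ i → TightOn χ i → value (δ G (P i)) ⊆ value F
    tight-χ⇒ i tight {e} e∈δ = cases (e ∈? value F)
      where
      ê : Elem (E G)
      ê = e , [ p∩q⊆p (E G) _ e∈δ ]
      cases : Dec (e ∈ value F) → e ∈ value F
      cases (yes e∈F) = e∈F
      cases (no  e∉F) = contradiction
        (fromℤ-cancel {+ 1} {+ 0} (subst (1ᵣ ≲_) (mask-∉ 1ᵣ e∉F) (≈⇒≳ {χ ê} {1ᵣ} (tight ê e∈δ))))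
        λ { (ℤ.+≤+ ()) }

    tight-χ⇐ : ∀ i → value (δ G (P i)) ⊆ value F → TightOn χ i
    tight-χ⇐ i δ⊆F ê e∈δ = subst (_≈ᵣ 1ᵣ) (sym (mask-∈ 1ᵣ (δ⊆F e∈δ))) (≲-antisym {1ᵣ} {1ᵣ} ≲-refl ≲-refl)

    feasible⇒ : FeasibleCRNDP G f F → ∀ i →
      value (δ G (P i)) ⊆ value F × FeasibleNDP (G ⟨ P i ⟩) (fs i) (edgesWithin G F (P i))
    feasible⇒ feas i =
      let tight , region = region⇒ χ (Equivalence.to (feasibleCR⇔region G F χ (λ _ → refl) f) feas) i
      in tight-χ⇒ i tight
       , Equivalence.from (feasible⇔region (G ⟨ P i ⟩) (edgesWithin G F (P i))
           (restrict G χ (P i)) (χ-restrict i) (fs i)) region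

    feasible⇐ : (∀ i → value (δ G (P i)) ⊆ value F
                     × FeasibleNDP (G ⟨ P i ⟩) (fs i) (edgesWithin G F (P i))) → FeasibleCRNDP G f F
    feasible⇐ parts = Equivalence.from (feasibleCR⇔region G F χ (λ _ → refl) f)
      (region⇐ χ λ i → tight-χ⇐ i (proj₁ (parts i))
        , Equivalence.to (feasible⇔region (G ⟨ P i ⟩) (edgesWithin G F (P i))
            (restrict G χ (P i)) (χ-restrict i) (fs i)) (proj₂ (parts i)))

theorem4p1 : ∀ {n m : ℕ} (G : Graph n m) (f : 2^ V G → ℤ) →
    WeaklySupermodular f → Symmetric f → Normalized f →
    Σ[ k ∈ ℕ ] Σ[ P ∈ (Fin k → 2^ V G) ] Σ[ fs ∈ ((i : Fin k) → 2^ V (G ⟨ P i ⟩) → ℤ) ]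
    (IsPartition P
    × (∀ i → WeaklySupermodular (fs i) × Symmetric (fs i) × Normalized (fs i))
    × (∀ (F : 2^ E G) →
    FeasibleCRNDP G f F ⇔
    (∀ i → value (δ G (P i)) ⊆ value F
    × FeasibleNDP (G ⟨ P i ⟩) (fs i) (edgesWithin G F (P i))))
    × (∀ (x : EdgeVector G) →
    RegionCRLP G f x ⇔
    (∀ i → (∀ (e : Elem (E G)) → value e ∈ value (δ G (P i)) → x e ≈ᵣ 1ᵣ)
    × RegionNDP (G ⟨ P i ⟩) (fs i) (restrict G x (P i))))
    × (∀ (x : EdgeVector G) →
    ExtremePoint (RegionCRLP G f) x ⇔
    (∀ i → (∀ (e : Elem (E G)) → value e ∈ value (δ G (P i)) → x e ≈ᵣ 1ᵣ)
    × ExtremePoint (RegionNDP (G ⟨ P i ⟩) (fs i)) (restrict G x (P i)))))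
theorem4p1 G f wsm symm norm = size , P , fs , P-isPartition , fs-admissible
  , (λ F → mk⇔ (feasible⇒ F) (feasible⇐ F))
  , (λ x → mk⇔ (region⇒ x) (region⇐ x))
  , (λ x → mk⇔ (extreme⇒ x) (extreme⇐ x))
  where
  open Decompositions (E G) (ends G)
  open Transfer G f (decompose (<-wellFounded ∣ V G ∣) (extendSet-admissible G f wsm symm norm))
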